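{- Let $p$ be an odd prime and $n$ a positive integer. Then $$S_{np+1}\equiv\begin{cases}(4+12n-9n^2)S_n\pmod{p^3} & \text{if } p=3,\\ 4(np+1)S_n+32n^2S_{n-1}(-1)^{\frac{p-1}{2}}(E_{p-3}-1)p^2\pmod{p^3} & \text{if } p>3.\end{cases}$$
   Context: $(S_n)_{n\ge0}$ is the integer sequence defined by $S_0=1$, $S_1=4$ and $(n+1)^2S_{n+1}=4(3n^2+3n+1)S_n-32n^2S_{n-1}$ for $n\ge1$; equivalently $S_n=\sum_{k=0}^n\binom nk\binom{2k}k\binom{2n-2k}{n-k}$. The Euler numbers $E_n$ are defined by $E_0=1$, $E_{2n-1}=0$ and $\sum_{k=0}^n\binom{2n}{2k}E_{2k}=0$ for $n\ge1$. -}

module Defs where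

open import Data.Nat as ℕ using (ℕ)
open import Data.Nat.Combinatorics using (_C_)
open import Data.Fin using (toℕ)
open import Data.Integer using (ℤ; +_; _+_; _*_; _-_; _^_)
open import Data.Integer.Divisibility using (_∣_)
open import Data.Integer.Properties using (+-0-monoid)
open import Algebra.Properties.Monoid.Sum +-0-monoid using (sum⁺-syntax)
open import Relation.Binary.PropositionalEquality using (_≡_)

infix 4 _≡_[mod_]

_≡_[mod_] : ℤ → ℤ → ℤ → Set
a ≡ b [mod m ] = m ∣ a - b

-- (n+1)² is a nonzero integer, so at most one sequence satisfies these
-- equations; it is 1, 4, 20, 112, …, with
-- S n = Σₖ (n C k) * (2k C k) * ((2n-2k) C (n-k)).
record IsS (S : ℕ → ℤ) : Set where
  field
    S-zero : S 0 ≡ + 1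
    S-one  : S 1 ≡ + 4
    S-rec  : ∀ n → n ℕ.≥ 1 →
             (+ n + + 1) ^ 2 * S (n ℕ.+ 1)
               ≡ + 4 * (+ 3 * (+ n) ^ 2 + + 3 * + n + + 1) * S n
                 - + 32 * (+ n) ^ 2 * S (n ℕ.∸ 1)

-- The k = n summand in E-sum is E (2n), so the equations determine E.
record IsEuler (E : ℕ → ℤ) : Set where
  field
    E-zero : E 0 ≡ + 1
    E-odd  : ∀ n → n ℕ.≥ 1 → E (2 ℕ.* n ℕ.∸ 1) ≡ + 0
    E-sum  : ∀ n → n ℕ.≥ 1 →
             ∑[ k ≤ n ] (+ ((2 ℕ.* n) C (2 ℕ.* toℕ k)) * E (2 ℕ.* toℕ k)) ≡ + 0

{-# OPTIONS --safe #-}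

-- S n = Σ_{k+l=n} F k l with F k l = (k + l)! (2k)! (2l)! / (k! l!)³.  For S (N p), the terms
-- with p | k satisfy F (j p) (l p) ≡ F j l (mod p³), by Wolstenholme's theorem, when p > 3; for
-- p = 3 there is an explicit correction mod 27.  The other terms are divisible by p²; modulo p³
-- they sum to 4 p² N² S (N - 1) Σ_{r<p/2} (-1)^r / r², and the alternating sum is 2 (-1)^h E (p - 3)
-- modulo p, h = (p - 1)/2, because the rescaled Euler polynomial A of degree p - 3 has
-- A (t + 1) + A (t - 1) = 2 t^(p-3).  In S (N p - 1) only the terms whose indices both end in the
-- p-adic digit h survive modulo p, giving (-1)^h S (N - 1).  The recurrence at N p turns these two
-- congruences into the one for S (N p + 1).

module Submission where

open import Defs
open import Data.Empty using (⊥-elim)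
open import Data.Fin using (toℕ)
open import Data.Integer using (ℤ; +_; -1ℤ; 0ℤ; 1ℤ; _+_; _*_; _-_; -_; _^_; NonZero)
import Data.Integer.Divisibility.Signed as Signed
open import Data.Integer.Properties
open import Data.Integer.Tactic.RingSolver using (solve-∀)
open import Algebra.Properties.Monoid.Sum +-0-monoid using (sum⁺-syntax)
open import Data.Nat as ℕ using (ℕ; zero; suc; _!)
open import Data.Nat.Combinatorics using (_C_; nCk≡n!/k![n-k]!; k![n∸k]!∣n!; nCn≡1)
open import Data.Nat.Coprimality using (prime⇒coprime; coprime-Bézout)
open import Data.Nat.Divisibility using (_∤_; divides)
import Data.Nat.DivMod as ℕ
open import Data.Nat.GCD using (module Bézout)
open import Data.Nat.Primality using (Prime; ¬prime[1])
import Data.Nat.Properties as ℕ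
import Data.Nat.Tactic.RingSolver as ℕ
open import Data.Product using (_×_; ∃; _,_)
open import Data.Sum using (_⊎_; inj₁; inj₂)
open import Function using (flip)
open import Level using (0ℓ)
open import Relation.Binary.Bundles using (Setoid)
open import Relation.Binary.PropositionalEquality using (_≡_; refl; sym; trans; cong; cong₂; subst; module ≡-Reasoning)
import Relation.Binary.Reasoning.Setoid as SetoidReasoning

-- Convolutions and the binomial sum for S

-- Indexing by pairs with `k + l = n` turns divisibility into digit arithmetic. `F k l` is a product
-- of three binomial coefficients, so every carry out of the last base-p digit in `k + l`, `k + k`
-- or `l + l` contributes a factor p. The factorials are never divided: each congruence is
-- multiplied by the part of the denominator prime to p, which is cancelled as a unit. The
-- recurrence at N p weights S (N p - 1) by (N p)², so that value matters only modulo p, while S (N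
-- p) is needed modulo p³. This is the origin of `E (p - 3) - 1`: the non-multiples of p in S (N p)
-- contribute 4 * 4 * 2 = 32 times N² S (N - 1) (-1)^h E (p - 3) p², and S (N p - 1) contributes -32
-- times N² S (N - 1) (-1)^h p². The prime 3 stands apart because the argument for Σ 1/r² ≡ 0
-- inverts 2 * 3. There the correction modulo 27 involves Σ k l F k l, the same moment `Q` through
-- which the recurrence for the binomial sum is proved.

conv : (ℕ → ℕ → ℤ) → ℕ → ℤ
conv g zero    = g 0 0
conv g (suc n) = g 0 (suc n) + conv (λ k l → g (suc k) l) n

conv-cong : ∀ {f g} n → (∀ k l → k ℕ.+ l ≡ n → f k l ≡ g k l) → conv f n ≡ conv g n
conv-cong zero    f≡g = f≡g 0 0 refl
conv-cong (suc n) f≡g =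
  cong₂ _+_ (f≡g 0 (suc n) refl) (conv-cong n λ k l k+l≡n → f≡g (suc k) l (cong suc k+l≡n))

conv-last : ∀ g n → conv g (suc n) ≡ conv (λ k l → g k (suc l)) n + g (suc n) 0
conv-last g zero    = refl
conv-last g (suc n) =
  trans (cong₂ _+_ (refl {x = g 0 (suc (suc n))}) (conv-last (λ k l → g (suc k) l) n))
        (sym (+-assoc (g 0 (suc (suc n))) _ _))

conv-swap : ∀ g n → conv g n ≡ conv (flip g) n
conv-swap g zero    = refl
conv-swap g (suc n) = begin
  g 0 (suc n) + conv (λ k l → g (suc k) l) n  ≡⟨ +-comm (g 0 (suc n)) _ ⟩
  conv (λ k l → g (suc k) l) n + g 0 (suc n)  ≡⟨ cong (_+ g 0 (suc n)) (conv-swap _ n) ⟩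
  conv (λ k l → g (suc l) k) n + g 0 (suc n)  ≡⟨ conv-last (flip g) n ⟨
  conv (flip g) (suc n)                       ∎
  where open ≡-Reasoning

conv-+ : ∀ f g n → conv (λ k l → f k l + g k l) n ≡ conv f n + conv g n
conv-+ f g zero    = refl
conv-+ f g (suc n) =
  trans (cong₂ _+_ (refl {x = f 0 (suc n) + g 0 (suc n)}) (conv-+ (λ k l → f (suc k) l) (λ k l → g (suc k) l) n))
        (interchange (f 0 (suc n)) (g 0 (suc n)) _ _)
  where
  interchange : ∀ a b c d → a + b + (c + d) ≡ a + c + (b + d)
  interchange = solve-∀

conv-* : ∀ c g n → conv (λ k l → c * g k l) n ≡ c * conv g n
conv-* c g zero    = refl
conv-* c g (suc n) =
  trans (cong₂ _+_ (refl {x = c * g 0 (suc n)}) (conv-* c (λ k l → g (suc k) l) n)) (sym (*-distribˡ-+ c _ _))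

conv-split : ∀ g a m →
  conv g (a ℕ.+ suc m)
    ≡ conv (λ k l → g k (l ℕ.+ suc m)) a + conv (λ k l → g (suc a ℕ.+ k) l) m
conv-split g zero    m = refl
conv-split g (suc a) m =
  trans (cong₂ _+_ (refl {x = g 0 (suc a ℕ.+ suc m)}) (conv-split (λ k l → g (suc k) l) a m))
        (sym (+-assoc (g 0 (suc a ℕ.+ suc m)) _ _))

cube : ℤ → ℤ
cube x = x * x * x

fac : ℕ → ℤ
fac n = + (n !)

fac-suc : ∀ n → fac (suc n) ≡ + suc n * fac n
fac-suc n = pos-* (suc n) (n !)

fac-nonZero : ∀ n → NonZero (fac n)
fac-nonZero n = n ℕ.!≢0

C*!*! : ∀ k l → ((k ℕ.+ l) C k) ℕ.* (k ! ℕ.* l !) ≡ (k ℕ.+ l) !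
C*!*! k l = begin
  ((k ℕ.+ l) C k) ℕ.* (k ! ℕ.* l !)
    ≡⟨ cong (λ x → ((k ℕ.+ l) C k) ℕ.* (k ! ℕ.* x !)) (ℕ.m+n∸m≡n k l) ⟨
  ((k ℕ.+ l) C k) ℕ.* (k ! ℕ.* (k ℕ.+ l ℕ.∸ k) !)
    ≡⟨ cong (ℕ._* (k ! ℕ.* (k ℕ.+ l ℕ.∸ k) !)) (nCk≡n!/k![n-k]! (ℕ.m≤m+n k l)) ⟩
  ((k ℕ.+ l) ! ℕ./ (k ! ℕ.* (k ℕ.+ l ℕ.∸ k) !)) ℕ.* (k ! ℕ.* (k ℕ.+ l ℕ.∸ k) !)
    ≡⟨ ℕ.m/n*n≡m (k![n∸k]!∣n! (ℕ.m≤m+n k l)) ⟩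
  (k ℕ.+ l) ! ∎
  where
  open ≡-Reasoning
  instance _ = ℕ._!*_!≢0 k (k ℕ.+ l ℕ.∸ k)

F : ℕ → ℕ → ℤ
F k l = + (((k ℕ.+ l) C k) ℕ.* ((k ℕ.+ k) C k) ℕ.* ((l ℕ.+ l) C l))

cube-pos : ∀ n → cube (+ n) ≡ + (n ℕ.* n ℕ.* n)
cube-pos n = sym (trans (pos-* (n ℕ.* n) n) (cong (_* + n) (pos-* n n)))

-- The factorial formula with its denominator cleared. Identities and congruences for `F` are
-- obtained by multiplying with the nonzero `cube` and cancelling it afterwards.
F-fac : ∀ k l → F k l * cube (fac k * fac l) ≡ fac (k ℕ.+ l) * fac (k ℕ.+ k) * fac (l ℕ.+ l)
F-fac k l = begin
  F k l * cube (fac k * fac l)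
    ≡⟨ cong (λ x → F k l * cube x) (pos-* (k !) (l !)) ⟨
  F k l * cube (+ (k ! ℕ.* l !))
    ≡⟨ cong (F k l *_) (cube-pos (k ! ℕ.* l !)) ⟩
  F k l * + (k ! ℕ.* l ! ℕ.* (k ! ℕ.* l !) ℕ.* (k ! ℕ.* l !))
    ≡⟨ pos-* (((k ℕ.+ l) C k) ℕ.* ((k ℕ.+ k) C k) ℕ.* ((l ℕ.+ l) C l)) _ ⟨
  + (((k ℕ.+ l) C k) ℕ.* ((k ℕ.+ k) C k) ℕ.* ((l ℕ.+ l) C l)
      ℕ.* (k ! ℕ.* l ! ℕ.* (k ! ℕ.* l !) ℕ.* (k ! ℕ.* l !)))
    ≡⟨ cong +_ (regroup ((k ℕ.+ l) C k) ((k ℕ.+ k) C k) ((l ℕ.+ l) C l) (k !) (l !)) ⟩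
  + (((k ℕ.+ l) C k) ℕ.* (k ! ℕ.* l !) ℕ.* (((k ℕ.+ k) C k) ℕ.* (k ! ℕ.* k !))
      ℕ.* (((l ℕ.+ l) C l) ℕ.* (l ! ℕ.* l !)))
    ≡⟨ cong +_ (cong₂ ℕ._*_ (cong₂ ℕ._*_ (C*!*! k l) (C*!*! k k)) (C*!*! l l)) ⟩
  + ((k ℕ.+ l) ! ℕ.* (k ℕ.+ k) ! ℕ.* (l ℕ.+ l) !)
    ≡⟨ trans (pos-* ((k ℕ.+ l) ! ℕ.* (k ℕ.+ k) !) _) (cong (_* fac (l ℕ.+ l)) (pos-* ((k ℕ.+ l) !) _)) ⟩
  fac (k ℕ.+ l) * fac (k ℕ.+ k) * fac (l ℕ.+ l) ∎
  where
  open ≡-Reasoning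
  regroup : ∀ a b c x y → a ℕ.* b ℕ.* c ℕ.* (x ℕ.* y ℕ.* (x ℕ.* y) ℕ.* (x ℕ.* y))
    ≡ a ℕ.* (x ℕ.* y) ℕ.* (b ℕ.* (x ℕ.* x)) ℕ.* (c ℕ.* (y ℕ.* y))
  regroup = ℕ.solve-∀

cube-nonZero : ∀ a .{{_ : NonZero a}} → NonZero (cube a)
cube-nonZero a = i*j≢0 (a * a) a {{i*j≢0 a a}}

facs-nonZero : ∀ k l → NonZero (cube (fac k * fac l))
facs-nonZero k l = cube-nonZero (fac k * fac l) {{i*j≢0 (fac k) (fac l) {{fac-nonZero k}} {{fac-nonZero l}}}}

F-sym : ∀ k l → F k l ≡ F l k
F-sym k l = *-cancelʳ-≡ _ _ (cube (fac k * fac l)) {{facs-nonZero k l}} (begin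
  F k l * cube (fac k * fac l)                    ≡⟨ F-fac k l ⟩
  fac (k ℕ.+ l) * fac (k ℕ.+ k) * fac (l ℕ.+ l)   ≡⟨ cong (λ n → fac n * fac (k ℕ.+ k) * fac (l ℕ.+ l)) (ℕ.+-comm k l) ⟩
  fac (l ℕ.+ k) * fac (k ℕ.+ k) * fac (l ℕ.+ l)   ≡⟨ swap (fac (l ℕ.+ k)) _ _ ⟩
  fac (l ℕ.+ k) * fac (l ℕ.+ l) * fac (k ℕ.+ k)   ≡⟨ F-fac l k ⟨
  F l k * cube (fac l * fac k)                    ≡⟨ cong (λ x → F l k * cube x) (*-comm (fac l) (fac k)) ⟩
  F l k * cube (fac k * fac l)                    ∎)
  where
  open ≡-Reasoning
  swap : ∀ a b c → a * b * c ≡ a * c * b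
  swap = solve-∀

-- The quotient of consecutive terms is (k+l+1)(2k+2)(2k+1)/(k+1)³, in which one factor k+1 cancels
-- against 2k+2. That factor reappears as the additional `+ suc k` in the quantity cancelled by the
-- proof.
F-sucˡ : ∀ k l → + suc k * + suc k * F (suc k) l
  ≡ + 2 * + suc (k ℕ.+ l) * (+ 2 * + k + 1ℤ) * F k l
F-sucˡ k l = *-cancelʳ-≡ _ _ (+ suc k * cube (fac k * fac l)) {{i*j≢0 (+ suc k) (cube (fac k * fac l)) {{_}} {{facs-nonZero k l}}}} (begin
  + suc k * + suc k * F (suc k) l * (+ suc k * cube (fac k * fac l))
    ≡⟨ e₁ (+ suc k) (F (suc k) l) (fac k) (fac l) ⟩
  F (suc k) l * cube (+ suc k * fac k * fac l)
    ≡⟨ cong (λ x → F (suc k) l * cube (x * fac l)) (fac-suc k) ⟨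
  F (suc k) l * cube (fac (suc k) * fac l)
    ≡⟨ F-fac (suc k) l ⟩
  fac (suc (k ℕ.+ l)) * fac (suc k ℕ.+ suc k) * fac (l ℕ.+ l)
    ≡⟨ cong (_* fac (l ℕ.+ l)) (cong₂ _*_ (fac-suc (k ℕ.+ l)) fac-2k+2) ⟩
  + suc (k ℕ.+ l) * fac (k ℕ.+ l) * (+ 2 * + suc k * ((+ 2 * + k + 1ℤ) * fac (k ℕ.+ k))) * fac (l ℕ.+ l)
    ≡⟨ e₂ (+ suc (k ℕ.+ l)) (fac (k ℕ.+ l)) (+ suc k) (+ 2 * + k + 1ℤ) (fac (k ℕ.+ k)) (fac (l ℕ.+ l)) ⟩
  + 2 * + suc (k ℕ.+ l) * (+ 2 * + k + 1ℤ) * + suc k * (fac (k ℕ.+ l) * fac (k ℕ.+ k) * fac (l ℕ.+ l))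
    ≡⟨ cong (+ 2 * + suc (k ℕ.+ l) * (+ 2 * + k + 1ℤ) * + suc k *_) (F-fac k l) ⟨
  + 2 * + suc (k ℕ.+ l) * (+ 2 * + k + 1ℤ) * + suc k * (F k l * cube (fac k * fac l))
    ≡⟨ e₃ (+ 2 * + suc (k ℕ.+ l) * (+ 2 * + k + 1ℤ)) (+ suc k) (F k l) (cube (fac k * fac l)) ⟩
  + 2 * + suc (k ℕ.+ l) * (+ 2 * + k + 1ℤ) * F k l * (+ suc k * cube (fac k * fac l)) ∎)
  where
  open ≡-Reasoning
  e₁ : ∀ s f a b → s * s * f * (s * (a * b * (a * b) * (a * b))) ≡ f * (s * a * b * (s * a * b) * (s * a * b))
  e₁ = solve-∀
  e₂ : ∀ a b c d e f → a * b * (+ 2 * c * (d * e)) * f ≡ + 2 * a * d * c * (b * e * f)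
  e₂ = solve-∀
  e₃ : ∀ a b c d → a * b * (c * d) ≡ a * c * (b * d)
  e₃ = solve-∀
  double : ∀ x → 1ℤ + x + (1ℤ + x) ≡ + 2 * (1ℤ + x)
  double = solve-∀
  double+1 : ∀ x → 1ℤ + (x + x) ≡ + 2 * x + 1ℤ
  double+1 = solve-∀
  fac-2k+2 : fac (suc k ℕ.+ suc k) ≡ + 2 * + suc k * ((+ 2 * + k + 1ℤ) * fac (k ℕ.+ k))
  fac-2k+2 = begin
    fac (suc k ℕ.+ suc k)
      ≡⟨ fac-suc (k ℕ.+ suc k) ⟩
    (+ suc k + + suc k) * fac (k ℕ.+ suc k)
      ≡⟨ cong₂ (λ x y → x * fac y) (double (+ k)) (ℕ.+-suc k k) ⟩
    + 2 * + suc k * fac (suc (k ℕ.+ k))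
      ≡⟨ cong (+ 2 * + suc k *_) (fac-suc (k ℕ.+ k)) ⟩
    + 2 * + suc k * ((1ℤ + (+ k + + k)) * fac (k ℕ.+ k))
      ≡⟨ cong (λ x → + 2 * + suc k * (x * fac (k ℕ.+ k))) (double+1 (+ k)) ⟩
    + 2 * + suc k * ((+ 2 * + k + 1ℤ) * fac (k ℕ.+ k)) ∎

-- `T` is the binomial sum. The moment `Q` closes the system: `T-suc` and `Q-suc` are first-order
-- relations between the two, and eliminating `Q` yields the second-order recurrence.
T Q : ℕ → ℤ
T = conv F
Q = conv (λ k l → + k * + l * F k l)

-- Multiplying a convolution of a symmetric kernel by 2 replaces the weight k by k + l.
conv-weight : ∀ n → conv (λ k l → + 2 * (+ k * F k l)) n ≡ + n * T n
conv-weight n = begin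
  conv (λ k l → + 2 * (+ k * F k l)) n
    ≡⟨ conv-* (+ 2) _ n ⟩
  + 2 * conv kF n
    ≡⟨ two (conv kF n) ⟩
  conv kF n + conv kF n
    ≡⟨ cong₂ _+_ (refl {x = conv kF n}) (conv-swap kF n) ⟩
  conv kF n + conv (flip kF) n
    ≡⟨ conv-+ kF (flip kF) n ⟨
  conv (λ k l → + k * F k l + + l * F l k) n
    ≡⟨ conv-cong n (λ k l k+l≡n → trans (cong (λ x → + k * F k l + + l * x) (F-sym l k))
         (trans (sym (*-distribʳ-+ (F k l) (+ k) (+ l))) (cong (λ x → + x * F k l) k+l≡n))) ⟩
  conv (λ k l → + n * F k l) n
    ≡⟨ conv-* (+ n) F n ⟩
  + n * T n ∎
  where
  open ≡-Reasoning
  kF : ℕ → ℕ → ℤ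
  kF k l = + k * F k l
  two : ∀ x → + 2 * x ≡ x + x
  two = solve-∀

conv-odd-weight : ∀ n → conv (λ k l → (+ 2 * + k + 1ℤ) * F k l) n ≡ (+ n + 1ℤ) * T n
conv-odd-weight n = begin
  conv (λ k l → (+ 2 * + k + 1ℤ) * F k l) n
    ≡⟨ conv-cong n (λ k l _ → e (+ k) (F k l)) ⟩
  conv (λ k l → + 2 * (+ k * F k l) + F k l) n
    ≡⟨ conv-+ (λ k l → + 2 * (+ k * F k l)) F n ⟩
  conv (λ k l → + 2 * (+ k * F k l)) n + T n
    ≡⟨ cong (_+ T n) (conv-weight n) ⟩
  + n * T n + T n
    ≡⟨ e′ (+ n) (T n) ⟩
  (+ n + 1ℤ) * T n ∎
  where
  open ≡-Reasoning
  e : ∀ k f → (+ 2 * k + 1ℤ) * f ≡ + 2 * (k * f) + f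
  e = solve-∀
  e′ : ∀ k f → k * f + f ≡ (k + 1ℤ) * f
  e′ = solve-∀

-- F-sucˡ turns the weight k² into a shift of the index k.
conv-square-weight : ∀ (w : ℕ → ℤ) n →
  conv (λ k l → w l * (+ k * + k * F k l)) (suc n)
    ≡ + 2 * + suc n * conv (λ k l → w l * ((+ 2 * + k + 1ℤ) * F k l)) n
conv-square-weight w n = begin
  w (suc n) * (0ℤ * F 0 (suc n)) + conv (λ k l → w l * (+ suc k * + suc k * F (suc k) l)) n
    ≡⟨ cong₂ _+_ (*-zeroʳ (w (suc n)))
        (conv-cong n λ k l k+l≡n → trans (cong (w l *_) (F-sucˡ k l))
          (trans (cong (λ x → w l * (+ 2 * + suc x * (+ 2 * + k + 1ℤ) * F k l)) k+l≡n)
            (e (w l) (+ suc n) (+ 2 * + k + 1ℤ) (F k l)))) ⟩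
  0ℤ + conv (λ k l → + 2 * + suc n * (w l * ((+ 2 * + k + 1ℤ) * F k l))) n
    ≡⟨ +-identityˡ _ ⟩
  conv (λ k l → + 2 * + suc n * (w l * ((+ 2 * + k + 1ℤ) * F k l))) n
    ≡⟨ conv-* (+ 2 * + suc n) _ n ⟩
  + 2 * + suc n * conv (λ k l → w l * ((+ 2 * + k + 1ℤ) * F k l)) n ∎
  where
  open ≡-Reasoning
  e : ∀ w n k f → w * (+ 2 * n * k * f) ≡ + 2 * n * (w * (k * f))
  e = solve-∀

-- Expand (k + l)² as k² + l² + 2kl under the sum. By symmetry the two squares contribute equally,
-- and `conv-square-weight` with `conv-odd-weight` evaluates them; the mixed term is `Q`.
T-suc : ∀ n → + suc n * + suc n * T (suc n) ≡ + 4 * (+ suc n * + suc n) * T n + + 2 * Q (suc n)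
T-suc n = begin
  + suc n * + suc n * T (suc n)
    ≡⟨ conv-* (+ suc n * + suc n) F (suc n) ⟨
  conv (λ k l → + suc n * + suc n * F k l) (suc n)
    ≡⟨ conv-cong (suc n) (λ k l k+l≡n → trans (cong (λ x → + x * + x * F k l) (sym k+l≡n))
        (trans (e (+ k) (+ l) (F k l)) (cong (λ x → k²F k l + (1ℤ * (+ l * + l * x) + + 2 * (+ k * + l * F k l))) (F-sym k l)))) ⟩
  conv (λ k l → k²F k l + (k²F l k + + 2 * (+ k * + l * F k l))) (suc n)
    ≡⟨ trans (conv-+ k²F (λ k l → k²F l k + 2klF k l) (suc n))
         (cong₂ _+_ (refl {x = conv k²F (suc n)}) (conv-+ (flip k²F) 2klF (suc n))) ⟩
  conv k²F (suc n) + (conv (flip k²F) (suc n) + conv (λ k l → + 2 * (+ k * + l * F k l)) (suc n))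
    ≡⟨ cong₂ (λ x y → conv k²F (suc n) + (x + y)) (sym (conv-swap k²F (suc n))) (conv-* (+ 2) klF (suc n)) ⟩
  conv k²F (suc n) + (conv k²F (suc n) + + 2 * Q (suc n))
    ≡⟨ cong (λ x → x + (x + + 2 * Q (suc n))) eval ⟩
  + 2 * + suc n * (+ suc n * T n) + (+ 2 * + suc n * (+ suc n * T n) + + 2 * Q (suc n))
    ≡⟨ e′ (+ suc n) (T n) (Q (suc n)) ⟩
  + 4 * (+ suc n * + suc n) * T n + + 2 * Q (suc n) ∎
  where
  open ≡-Reasoning
  k²F : ℕ → ℕ → ℤ
  k²F k l = 1ℤ * (+ k * + k * F k l)
  klF 2klF : ℕ → ℕ → ℤ
  klF k l = + k * + l * F k l
  2klF k l = + 2 * klF k l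
  e : ∀ k l f → (k + l) * (k + l) * f ≡ 1ℤ * (k * k * f) + (1ℤ * (l * l * f) + + 2 * (k * l * f))
  e = solve-∀
  e′ : ∀ n t q → + 2 * n * (n * t) + (+ 2 * n * (n * t) + + 2 * q) ≡ + 4 * (n * n) * t + + 2 * q
  e′ = solve-∀
  eval : conv k²F (suc n) ≡ + 2 * + suc n * (+ suc n * T n)
  eval = trans (conv-square-weight (λ _ → 1ℤ) n) (cong (+ 2 * + suc n *_)
    (trans (conv-cong n λ k l _ → *-identityˡ _)
      (trans (conv-odd-weight n) (cong (_* T n) (+-comm (+ n) 1ℤ)))))

-- Multiplication by n + 1 = k + l turns the weight kl into lk² + kl², two mirror images to which
-- `conv-square-weight` applies. The remaining sum `R` is evaluated only after doubling, because
-- `conv-weight` knows twice the first moment.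
Q-suc : ∀ n → Q (suc n) ≡ + 8 * Q n + + 2 * + n * T n
Q-suc n = *-cancelʳ-≡ _ _ (+ suc n) (begin
  Q (suc n) * + suc n
    ≡⟨ *-comm (Q (suc n)) (+ suc n) ⟩
  + suc n * Q (suc n)
    ≡⟨ conv-* (+ suc n) (λ k l → + k * + l * F k l) (suc n) ⟨
  conv (λ k l → + suc n * (+ k * + l * F k l)) (suc n)
    ≡⟨ conv-cong (suc n) (λ k l k+l≡n → trans (cong (λ x → + x * (+ k * + l * F k l)) (sym k+l≡n))
        (trans (e₁ (+ k) (+ l) (F k l)) (cong (λ x → lk²F k l + + k * (+ l * + l * x)) (F-sym k l)))) ⟩
  conv (λ k l → lk²F k l + lk²F l k) (suc n)
    ≡⟨ conv-+ lk²F (flip lk²F) (suc n) ⟩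
  conv lk²F (suc n) + conv (flip lk²F) (suc n)
    ≡⟨ cong₂ _+_ (refl {x = conv lk²F (suc n)}) (conv-swap lk²F (suc n)) ⟨
  conv lk²F (suc n) + conv lk²F (suc n)
    ≡⟨ cong (λ x → x + x) (conv-square-weight +_ n) ⟩
  + 2 * + suc n * R + + 2 * + suc n * R
    ≡⟨ e₂ (+ suc n) R ⟩
  + 2 * (+ 2 * R) * + suc n
    ≡⟨ cong (λ x → + 2 * x * + suc n) R-eval ⟩
  + 2 * (+ 4 * Q n + + n * T n) * + suc n
    ≡⟨ cong (_* + suc n) (e₃ (Q n) (+ n) (T n)) ⟩
  (+ 8 * Q n + + 2 * + n * T n) * + suc n ∎)
  where
  open ≡-Reasoning
  lk²F : ℕ → ℕ → ℤ
  lk²F k l = + l * (+ k * + k * F k l)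
  R : ℤ
  R = conv (λ k l → + l * ((+ 2 * + k + 1ℤ) * F k l)) n
  e₁ : ∀ k l f → (k + l) * (k * l * f) ≡ l * (k * k * f) + k * (l * l * f)
  e₁ = solve-∀
  e₂ : ∀ n r → + 2 * n * r + + 2 * n * r ≡ + 2 * (+ 2 * r) * n
  e₂ = solve-∀
  e₃ : ∀ q n t → + 2 * (+ 4 * q + n * t) ≡ + 8 * q + + 2 * n * t
  e₃ = solve-∀
  e₄ : ∀ k l f → + 2 * (l * ((+ 2 * k + 1ℤ) * f)) ≡ + 4 * (k * l * f) + + 2 * (l * f)
  e₄ = solve-∀
  R-eval : + 2 * R ≡ + 4 * Q n + + n * T n
  R-eval = begin
    + 2 * R
      ≡⟨ conv-* (+ 2) _ n ⟨
    conv (λ k l → + 2 * (+ l * ((+ 2 * + k + 1ℤ) * F k l))) n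
      ≡⟨ conv-cong n (λ k l _ → trans (e₄ (+ k) (+ l) (F k l))
           (cong (λ x → + 4 * (+ k * + l * F k l) + + 2 * (+ l * x)) (F-sym k l))) ⟩
    conv (λ k l → + 4 * (+ k * + l * F k l) + + 2 * (+ l * F l k)) n
      ≡⟨ conv-+ (λ k l → + 4 * (+ k * + l * F k l)) _ n ⟩
    conv (λ k l → + 4 * (+ k * + l * F k l)) n + conv (λ k l → + 2 * (+ l * F l k)) n
      ≡⟨ cong₂ _+_ (conv-* (+ 4) _ n) (trans (sym (conv-swap (λ k l → + 2 * (+ k * F k l)) n)) (conv-weight n)) ⟩
    + 4 * Q n + + n * T n ∎

T-rec : ∀ n → + suc (suc n) * + suc (suc n) * T (suc (suc n))
  ≡ + 4 * (+ 3 * (+ suc n * + suc n) + + 3 * + suc n + 1ℤ) * T (suc n) - + 32 * (+ suc n * + suc n) * T n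
T-rec n = begin
  + suc (suc n) * + suc (suc n) * T (suc (suc n))
    ≡⟨ T-suc (suc n) ⟩
  + 4 * (+ suc (suc n) * + suc (suc n)) * T (suc n) + + 2 * Q (suc (suc n))
    ≡⟨ cong (λ x → + 4 * (+ suc (suc n) * + suc (suc n)) * T (suc n) + + 2 * x) (Q-suc (suc n)) ⟩
  + 4 * (+ suc (suc n) * + suc (suc n)) * T (suc n) + + 2 * (+ 8 * Q (suc n) + + 2 * + suc n * T (suc n))
    -- The last summand is 8 times the difference of the two sides of `T-suc n`; it is arranged to
    -- absorb every occurrence of `Q`.
    ≡⟨ e₁ (+ suc n) (T (suc n)) (Q (suc n)) (T n) ⟩
  + 4 * (+ 3 * (+ suc n * + suc n) + + 3 * + suc n + 1ℤ) * T (suc n) - + 32 * (+ suc n * + suc n) * T n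
    + + 8 * (+ 4 * (+ suc n * + suc n) * T n + + 2 * Q (suc n) - + suc n * + suc n * T (suc n))
    ≡⟨ cong (λ x → + 4 * (+ 3 * (+ suc n * + suc n) + + 3 * + suc n + 1ℤ) * T (suc n) - + 32 * (+ suc n * + suc n) * T n
         + + 8 * (x - + suc n * + suc n * T (suc n))) (T-suc n) ⟨
  + 4 * (+ 3 * (+ suc n * + suc n) + + 3 * + suc n + 1ℤ) * T (suc n) - + 32 * (+ suc n * + suc n) * T n
    + + 8 * (+ suc n * + suc n * T (suc n) - + suc n * + suc n * T (suc n))
    ≡⟨ e₂ _ (+ suc n * + suc n * T (suc n)) ⟩
  + 4 * (+ 3 * (+ suc n * + suc n) + + 3 * + suc n + 1ℤ) * T (suc n) - + 32 * (+ suc n * + suc n) * T n ∎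
  where
  open ≡-Reasoning
  e₁ : ∀ n t q t′ → + 4 * ((1ℤ + n) * (1ℤ + n)) * t + + 2 * (+ 8 * q + + 2 * n * t)
    ≡ + 4 * (+ 3 * (n * n) + + 3 * n + 1ℤ) * t - + 32 * (n * n) * t′ + + 8 * (+ 4 * (n * n) * t′ + + 2 * q - n * n * t)
  e₁ = solve-∀
  e₂ : ∀ a b → a + + 8 * (b - b) ≡ a
  e₂ = solve-∀

module _ {S : ℕ → ℤ} (isS : IsS S) where
  open IsS isS

  S-rec′ : ∀ n → + suc (suc n) * + suc (suc n) * S (suc (suc n))
    ≡ + 4 * (+ 3 * (+ suc n * + suc n) + + 3 * + suc n + 1ℤ) * S (suc n) - + 32 * (+ suc n * + suc n) * S n
  S-rec′ n = trans (cong₂ (λ x y → x * S y) (e₁ (+ n)) (sym (ℕ.+-comm (suc n) 1)))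
    (trans (S-rec (suc n) (ℕ.s≤s ℕ.z≤n)) (e₂ (+ suc n) (S (suc n)) (S n)))
    where
    e₁ : ∀ n → (+ 2 + n) * (+ 2 + n) ≡ (1ℤ + n + 1ℤ) * ((1ℤ + n + 1ℤ) * 1ℤ)
    e₁ = solve-∀
    e₂ : ∀ n t t′ → + 4 * (+ 3 * (n * (n * 1ℤ)) + + 3 * n + 1ℤ) * t - + 32 * (n * (n * 1ℤ)) * t′
      ≡ + 4 * (+ 3 * (n * n) + + 3 * n + 1ℤ) * t - + 32 * (n * n) * t′
    e₂ = solve-∀

  -- Both sequences satisfy the same recurrence, whose leading coefficient (n + 2)² is nonzero and
  -- can be cancelled.
  S≡T : ∀ n → S n ≡ T n
  S≡T zero          = S-zero
  S≡T (suc zero)    = S-one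
  S≡T (suc (suc n)) = *-cancelˡ-≡ (+ suc (suc n) * + suc (suc n)) _ _ (trans (S-rec′ n)
    (trans (cong₂ (λ x y → + 4 * (+ 3 * (+ suc n * + suc n) + + 3 * + suc n + 1ℤ) * x - + 32 * (+ suc n * + suc n) * y)
             (S≡T (suc n)) (S≡T n))
      (sym (T-rec n))))

-- Congruences of integers

infix 4 _≈_[_]

-- The signed quotient is kept as data, so closure properties and explicit witnesses become
-- polynomial identities for the ring solver. `≈⇒mod` passes to the divisibility of the statement.
record _≈_[_] (a b m : ℤ) : Set where
  constructor quot
  field
    quotient : ℤ
    equality : a ≡ b + quotient * m

≡⇒≈ : ∀ {a b m} → a ≡ b → a ≈ b [ m ]
≡⇒≈ {a} refl = quot 0ℤ (sym (+-identityʳ a))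

≈-refl : ∀ {a m} → a ≈ a [ m ]
≈-refl = ≡⇒≈ refl

≈-sym : ∀ {a b m} → a ≈ b [ m ] → b ≈ a [ m ]
≈-sym {b = b} {m} (quot q refl) = quot (- q) (e b q m)
  where
  e : ∀ b q m → b ≡ b + q * m + - q * m
  e = solve-∀

≈-trans : ∀ {a b c m} → a ≈ b [ m ] → b ≈ c [ m ] → a ≈ c [ m ]
≈-trans {c = c} {m} (quot q refl) (quot r refl) = quot (r + q) (e c q r m)
  where
  e : ∀ c q r m → c + r * m + q * m ≡ c + (r + q) * m
  e = solve-∀

≈-setoid : ℤ → Setoid 0ℓ 0ℓ
≈-setoid m = record
  { Carrier       = ℤ
  ; _≈_           = _≈_[ m ]
  ; isEquivalence = record { refl = ≈-refl ; sym = ≈-sym ; trans = ≈-trans }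
  }

module ≈-Reasoning m = SetoidReasoning (≈-setoid m)

+-≈ : ∀ {a b c d m} → a ≈ b [ m ] → c ≈ d [ m ] → a + c ≈ b + d [ m ]
+-≈ {b = b} {d = d} {m} (quot q refl) (quot r refl) = quot (q + r) (e b d q r m)
  where
  e : ∀ b d q r m → b + q * m + (d + r * m) ≡ b + d + (q + r) * m
  e = solve-∀

*-≈ : ∀ {a b c d m} → a ≈ b [ m ] → c ≈ d [ m ] → a * c ≈ b * d [ m ]
*-≈ {b = b} {d = d} {m} (quot q refl) (quot r refl) = quot (q * d + b * r + q * r * m) (e b d q r m)
  where
  e : ∀ b d q r m → (b + q * m) * (d + r * m) ≡ b * d + (q * d + b * r + q * r * m) * m
  e = solve-∀

*-≈ˡ : ∀ {a b m} c → a ≈ b [ m ] → c * a ≈ c * b [ m ]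
*-≈ˡ c = *-≈ (≈-refl {c})

*-≈ʳ : ∀ {a b m} c → a ≈ b [ m ] → a * c ≈ b * c [ m ]
*-≈ʳ c a≈b = *-≈ a≈b (≈-refl {c})

cube-≈ : ∀ {a b m} → a ≈ b [ m ] → cube a ≈ cube b [ m ]
cube-≈ a≈b = *-≈ (*-≈ a≈b a≈b) a≈b

^-≈ : ∀ {a b m} n → a ≈ b [ m ] → a ^ n ≈ b ^ n [ m ]
^-≈ zero    a≈b = ≈-refl
^-≈ (suc n) a≈b = *-≈ a≈b (^-≈ n a≈b)

multiple≈0 : ∀ q {m} → q * m ≈ 0ℤ [ m ]
multiple≈0 q {m} = quot q (sym (+-identityˡ (q * m)))

-- This is how precision is gained: beside a factor `P * P`, a congruence modulo `P` becomes one
-- modulo `P * P * P`.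
≈-scale : ∀ {a b m} c → a ≈ b [ m ] → c * a ≈ c * b [ c * m ]
≈-scale {b = b} {m} c (quot q refl) = quot q (e b c q m)
  where
  e : ∀ b c q m → c * (b + q * m) ≡ c * b + q * (c * m)
  e = solve-∀

conv-≈ : ∀ {f g m} n → (∀ k l → k ℕ.+ l ≡ n → f k l ≈ g k l [ m ]) → conv f n ≈ conv g n [ m ]
conv-≈ zero    f≈g = f≈g 0 0 refl
conv-≈ (suc n) f≈g =
  +-≈ (f≈g 0 (suc n) refl) (conv-≈ n λ k l k+l≡n → f≈g (suc k) l (cong suc k+l≡n))

conv-0 : ∀ n → conv (λ _ _ → 0ℤ) n ≡ 0ℤ
conv-0 zero    = refl
conv-0 (suc n) = trans (+-identityˡ _) (conv-0 n)

-- Units modulo m and modulo its cube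

record Unit (m u : ℤ) : Set where
  constructor unit
  field
    inverse  : ℤ
    isInverse : u * inverse ≈ 1ℤ [ m ]

unit-cancelʳ : ∀ {m u a b} → Unit m u → a * u ≈ b * u [ m ] → a ≈ b [ m ]
unit-cancelʳ {m} {u} {a} {b} (unit v uv≈1) au≈bu = begin
  a            ≡⟨ *-identityʳ a ⟨
  a * 1ℤ       ≈⟨ *-≈ˡ a uv≈1 ⟨
  a * (u * v)  ≡⟨ *-assoc a u v ⟨
  a * u * v    ≈⟨ *-≈ʳ v au≈bu ⟩
  b * u * v    ≡⟨ *-assoc b u v ⟩
  b * (u * v)  ≈⟨ *-≈ˡ b uv≈1 ⟩
  b * 1ℤ       ≡⟨ *-identityʳ b ⟩
  b            ∎
  where open ≈-Reasoning m

unit-1 : ∀ {m} → Unit m 1ℤ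
unit-1 = unit 1ℤ ≈-refl

unit-* : ∀ {m u u′} → Unit m u → Unit m u′ → Unit m (u * u′)
unit-* {m} {u} {u′} (unit v uv≈1) (unit v′ u′v′≈1) =
  unit (v * v′) (≈-trans (≡⇒≈ (e u u′ v v′)) (*-≈ uv≈1 u′v′≈1))
  where
  e : ∀ u u′ v v′ → u * u′ * (v * v′) ≡ u * v * (u′ * v′)
  e = solve-∀

unit-cube : ∀ {m u} → Unit m u → Unit m (cube u)
unit-cube u = unit-* (unit-* u u) u

unit-^ : ∀ {m u} n → Unit m u → Unit m (u ^ n)
unit-^ zero    u = unit-1
unit-^ (suc n) u = unit-* u (unit-^ n u)

unit-≈ : ∀ {m u u′} → u ≈ u′ [ m ] → Unit m u → Unit m u′
unit-≈ u≈u′ (unit v uv≈1) = unit v (≈-trans (*-≈ʳ v (≈-sym u≈u′)) uv≈1)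

-- If u v = 1 + q m, then u v (1 - q m + q² m²) = 1 + q³ m³.
unit-lift : ∀ {m u} → Unit m u → Unit (m * m * m) u
unit-lift {m} {u} (unit v (quot q uv≡1+qm)) = unit (v * (1ℤ - q * m + q * m * (q * m))) (quot (q * q * q) (begin
  u * (v * (1ℤ - q * m + q * m * (q * m)))          ≡⟨ *-assoc u v _ ⟨
  u * v * (1ℤ - q * m + q * m * (q * m))            ≡⟨ cong (_* (1ℤ - q * m + q * m * (q * m))) uv≡1+qm ⟩
  (1ℤ + q * m) * (1ℤ - q * m + q * m * (q * m))     ≡⟨ e q m ⟩
  1ℤ + q * q * q * (m * m * m)                      ∎))
  where
  open ≡-Reasoning
  e : ∀ q m → (1ℤ + q * m) * (1ℤ - q * m + q * m * (q * m)) ≡ 1ℤ + q * q * q * (m * m * m)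
  e = solve-∀

-- Natural-number Bézout coefficients come in two orientations; in the one where `y` times the
-- number is 1 less than a multiple of p, the inverse is `- (+ y)`.
unit-<prime : ∀ {p a} → Prime p → suc a ℕ.< p → Unit (+ p) (+ suc a)
unit-<prime {p} {a} p-prime a<p with coprime-Bézout (prime⇒coprime p-prime a<p)
... | Bézout.+- x y 1+ya≡xp = unit (- (+ y)) (quot (- (+ x)) (begin
    + suc a * - (+ y)          ≡⟨ e₁ (+ suc a) (+ y) ⟩
    1ℤ + - (1ℤ + + y * + suc a) ≡⟨ cong (λ z → 1ℤ + - (1ℤ + z)) (pos-* y (suc a)) ⟨
    1ℤ + - (+ (1 ℕ.+ y ℕ.* suc a)) ≡⟨ cong (λ z → 1ℤ + - (+ z)) 1+ya≡xp ⟩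
    1ℤ + - (+ (x ℕ.* p))       ≡⟨ cong (λ z → 1ℤ + - z) (pos-* x p) ⟩
    1ℤ + - (+ x * + p)         ≡⟨ cong (λ z → 1ℤ + z) (neg-distribˡ-* (+ x) (+ p)) ⟩
    1ℤ + - (+ x) * + p         ∎))
  where
  open ≡-Reasoning
  e₁ : ∀ a y → a * - y ≡ 1ℤ + - (1ℤ + y * a)
  e₁ = solve-∀
... | Bézout.-+ x y 1+xp≡ya = unit (+ y) (quot (+ x) (begin
    + suc a * + y          ≡⟨ *-comm (+ suc a) (+ y) ⟩
    + y * + suc a          ≡⟨ pos-* y (suc a) ⟨
    + (y ℕ.* suc a)        ≡⟨ cong +_ 1+xp≡ya ⟨
    1ℤ + + (x ℕ.* p)       ≡⟨ cong (λ z → 1ℤ + z) (pos-* x p) ⟩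
    1ℤ + + x * + p         ∎))
  where open ≡-Reasoning

unit-fac : ∀ {p} a → Prime p → a ℕ.< p → Unit (+ p) (fac a)
unit-fac zero    p-prime a<p = unit-1
unit-fac (suc a) p-prime a<p = subst (Unit _) (sym (fac-suc a))
  (unit-* (unit-<prime p-prime a<p) (unit-fac a p-prime (ℕ.<-trans (ℕ.n<1+n a) a<p)))

-- Convolutions split by the last base-p digit

-- The last digits of two numbers with sum n p + (p - 1) add up to p - 1 modulo p and to at most 2p
-- - 2, hence to exactly p - 1. No carry occurs, so the quotients add up to `n`.
conv-digits : ∀ g q n → conv g (n ℕ.* suc q ℕ.+ q)
  ≡ conv (λ j l → conv (λ r s → g (j ℕ.* suc q ℕ.+ r) (l ℕ.* suc q ℕ.+ s)) q) n
conv-digits g q zero    = refl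
conv-digits g q (suc n) = begin
  conv g (suc n ℕ.* suc q ℕ.+ q)
    ≡⟨ cong (conv g) (e₁ q (n ℕ.* suc q)) ⟩
  conv g (q ℕ.+ suc (n ℕ.* suc q ℕ.+ q))
    ≡⟨ conv-split g q (n ℕ.* suc q ℕ.+ q) ⟩
  conv (λ r s → g r (s ℕ.+ suc (n ℕ.* suc q ℕ.+ q))) q + conv (λ k l → g (suc q ℕ.+ k) l) (n ℕ.* suc q ℕ.+ q)
    ≡⟨ cong₂ _+_ (conv-cong q λ r s _ → cong (g r) (e₂ q (n ℕ.* suc q) s))
        (trans (conv-digits (λ k l → g (suc q ℕ.+ k) l) q n)
          (conv-cong n λ j l _ → conv-cong q λ r s _ →
            cong (λ x → g x (l ℕ.* suc q ℕ.+ s)) (sym (ℕ.+-assoc (suc q) (j ℕ.* suc q) r)))) ⟩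
  conv (λ j l → conv (λ r s → g (j ℕ.* suc q ℕ.+ r) (l ℕ.* suc q ℕ.+ s)) q) (suc n) ∎
  where
  open ≡-Reasoning
  e₁ : ∀ q x → suc (q ℕ.+ x) ℕ.+ q ≡ q ℕ.+ suc (x ℕ.+ q)
  e₁ = ℕ.solve-∀
  e₂ : ∀ q x s → s ℕ.+ suc (x ℕ.+ q) ≡ suc (q ℕ.+ x) ℕ.+ s
  e₂ = ℕ.solve-∀

-- If the sum is a multiple of p, the last digits are either both 0 or add up to exactly p. The
-- second case carries, so its quotients add up to `n` and not `suc n`. Here p = q + 2, and both
-- digits are shifted down by 1.
conv-multiples : ∀ g q n → let p = suc (suc q) in conv g (suc n ℕ.* p)
  ≡ conv (λ j l → g (j ℕ.* p) (l ℕ.* p)) (suc n)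
    + conv (λ j l → conv (λ r s → g (j ℕ.* p ℕ.+ suc r) (l ℕ.* p ℕ.+ suc s)) q) n
conv-multiples g q n = begin
  conv g (suc n ℕ.* p)
    ≡⟨ cong (conv g) (e₁ (suc q) (n ℕ.* p)) ⟩
  conv g (suc q ℕ.+ suc (n ℕ.* p))
    ≡⟨ conv-split g (suc q) (n ℕ.* p) ⟩
  g 0 (suc q ℕ.+ suc (n ℕ.* p)) + conv (λ r s → g (suc r) (s ℕ.+ suc (n ℕ.* p))) q + conv (λ k l → g (p ℕ.+ k) l) (n ℕ.* p)
    ≡⟨ cong (_+ conv (λ k l → g (p ℕ.+ k) l) (n ℕ.* p))
        (cong₂ _+_ (cong (g 0) (sym (e₁ (suc q) (n ℕ.* p))))
          (conv-cong q λ r s _ → cong (g (suc r)) (e₂ (n ℕ.* p) s))) ⟩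
  g 0 (suc n ℕ.* p) + block n + conv (λ k l → g (p ℕ.+ k) l) (n ℕ.* p)
    ≡⟨ rest n ⟩
  conv (λ j l → g (j ℕ.* p) (l ℕ.* p)) (suc n)
    + conv (λ j l → conv (λ r s → g (j ℕ.* p ℕ.+ suc r) (l ℕ.* p ℕ.+ suc s)) q) n ∎
  where
  open ≡-Reasoning
  p = suc (suc q)
  block : ℕ → ℤ
  block n = conv (λ r s → g (suc r) (n ℕ.* p ℕ.+ suc s)) q
  e₁ : ∀ q x → suc (q ℕ.+ x) ≡ q ℕ.+ suc x
  e₁ = ℕ.solve-∀
  e₂ : ∀ x s → s ℕ.+ suc x ≡ x ℕ.+ suc s
  e₂ = ℕ.solve-∀
  interchange₀ : ∀ a b c → a + b + c ≡ a + c + b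
  interchange₀ = solve-∀
  interchange : ∀ a b c d → a + b + (c + d) ≡ a + c + (b + d)
  interchange = solve-∀
  rest : ∀ n → g 0 (suc n ℕ.* p) + block n + conv (λ k l → g (p ℕ.+ k) l) (n ℕ.* p)
    ≡ conv (λ j l → g (j ℕ.* p) (l ℕ.* p)) (suc n)
      + conv (λ j l → conv (λ r s → g (j ℕ.* p ℕ.+ suc r) (l ℕ.* p ℕ.+ suc s)) q) n
  rest zero    = interchange₀ (g 0 (1 ℕ.* p)) _ _
  rest (suc n) = begin
    g 0 (suc (suc n) ℕ.* p) + block (suc n) + conv (λ k l → g (p ℕ.+ k) l) (suc n ℕ.* p)
      ≡⟨ cong₂ _+_ (refl {x = g 0 (suc (suc n) ℕ.* p) + block (suc n)})
          (trans (conv-multiples (λ k l → g (p ℕ.+ k) l) q n)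
            (cong₂ _+_ (refl {x = conv (λ j l → g (suc j ℕ.* p) (l ℕ.* p)) (suc n)})
              (conv-cong n λ j l _ → conv-cong q λ r s _ →
                cong (λ x → g x (l ℕ.* p ℕ.+ suc s)) (sym (ℕ.+-assoc p (j ℕ.* p) (suc r)))))) ⟩
    g 0 (suc (suc n) ℕ.* p) + block (suc n)
      + (conv (λ j l → g (suc j ℕ.* p) (l ℕ.* p)) (suc n)
        + conv (λ j l → conv (λ r s → g (suc j ℕ.* p ℕ.+ suc r) (l ℕ.* p ℕ.+ suc s)) q) n)
      ≡⟨ interchange (g 0 (suc (suc n) ℕ.* p)) _ _ _ ⟩
    conv (λ j l → g (j ℕ.* p) (l ℕ.* p)) (suc (suc n))
      + conv (λ j l → conv (λ r s → g (j ℕ.* p ℕ.+ suc r) (l ℕ.* p ℕ.+ suc s)) q) (suc n) ∎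

F-sucʳ : ∀ k l → + suc l * + suc l * F k (suc l)
  ≡ + 2 * + suc (k ℕ.+ l) * (+ 2 * + l + 1ℤ) * F k l
F-sucʳ k l = trans (cong (λ x → + suc l * + suc l * x) (F-sym k (suc l)))
  (trans (F-sucˡ l k) (cong₂ (λ x y → + 2 * + suc x * (+ 2 * + l + 1ℤ) * y) (ℕ.+-comm l k) (F-sym l k)))

rise : ℤ → ℕ → ℤ
rise x zero    = 1ℤ
rise x (suc n) = rise x n * (x + + suc n)

fac-+ : ∀ a b → fac (a ℕ.+ b) ≡ fac a * rise (+ a) b
fac-+ a zero    = trans (cong fac (ℕ.+-identityʳ a)) (sym (*-identityʳ (fac a)))
fac-+ a (suc b) = begin
  fac (a ℕ.+ suc b)                        ≡⟨ cong fac (ℕ.+-suc a b) ⟩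
  fac (suc (a ℕ.+ b))                      ≡⟨ fac-suc (a ℕ.+ b) ⟩
  + suc (a ℕ.+ b) * fac (a ℕ.+ b)          ≡⟨ cong₂ (λ x y → + x * y) (sym (ℕ.+-suc a b)) (fac-+ a b) ⟩
  + (a ℕ.+ suc b) * (fac a * rise (+ a) b) ≡⟨ e (+ (a ℕ.+ suc b)) (fac a) (rise (+ a) b) ⟩
  fac a * (rise (+ a) b * (+ a + + suc b)) ∎
  where
  open ≡-Reasoning
  e : ∀ x y z → x * (y * z) ≡ y * (z * x)
  e = solve-∀

rise-≈ : ∀ {x y m} n → x ≈ y [ m ] → rise x n ≈ rise y n [ m ]
rise-≈ zero    x≈y = ≈-refl
rise-≈ (suc n) x≈y = *-≈ (rise-≈ n x≈y) (+-≈ x≈y ≈-refl)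

rise-0 : ∀ n → rise 0ℤ n ≡ fac n
rise-0 n = trans (sym (*-identityˡ (rise 0ℤ n))) (sym (fac-+ 0 n))

-- Factorials and their parts prime to p

[-1]^n*[-1]^n≡1 : ∀ n → -1ℤ ^ n * -1ℤ ^ n ≡ 1ℤ
[-1]^n*[-1]^n≡1 zero    = refl
[-1]^n*[-1]^n≡1 (suc n) = trans (e (-1ℤ ^ n)) ([-1]^n*[-1]^n≡1 n)
  where
  e : ∀ x → -1ℤ * x * (-1ℤ * x) ≡ x * x
  e = solve-∀

-- Numerator and denominator of `F j l` both have total weight 3(j + l), so a factor `x` per unit of
-- the index cancels. This serves for `x` equal to p, to (p - 1)! and, when p = 3, to 2.
pow-diag : ∀ x j l → x ^ (j ℕ.+ l) * x ^ (j ℕ.+ j) * x ^ (l ℕ.+ l) ≡ cube (x ^ j * x ^ l)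
pow-diag x j l = trans
  (cong₂ _*_ (cong₂ _*_ (^-distribˡ-+-* x j l) (^-distribˡ-+-* x j j)) (^-distribˡ-+-* x l l))
  (e (x ^ j) (x ^ l))
  where
  e : ∀ a b → a * b * (a * a) * (b * b) ≡ a * b * (a * b) * (a * b)
  e = solve-∀

-- One carry in `j + l` and one in `l + l` raise the numerator by `x * x`; at x = p this is the p²
-- of the terms off the multiples of p.
pow-carry : ∀ x j l → x ^ suc (j ℕ.+ l) * x ^ (j ℕ.+ j) * x ^ suc (l ℕ.+ l) ≡ x * x * cube (x ^ j * x ^ l)
pow-carry x j l = trans (e₁ x (x ^ (j ℕ.+ l)) _ _) (cong (x * x *_) (pow-diag x j l))
  where
  e₁ : ∀ x a b c → x * a * b * (x * c) ≡ x * x * (a * b * c)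
  e₁ = solve-∀

fac-carry : ∀ j l → fac (suc (j ℕ.+ l)) * fac (j ℕ.+ j) * fac (suc (l ℕ.+ l))
  ≡ + suc (j ℕ.+ l) * + suc (l ℕ.+ l) * F j l * cube (fac j * fac l)
fac-carry j l = begin
  fac (suc (j ℕ.+ l)) * fac (j ℕ.+ j) * fac (suc (l ℕ.+ l))
    ≡⟨ cong₂ (λ x y → x * fac (j ℕ.+ j) * y) (fac-suc (j ℕ.+ l)) (fac-suc (l ℕ.+ l)) ⟩
  + suc (j ℕ.+ l) * fac (j ℕ.+ l) * fac (j ℕ.+ j) * (+ suc (l ℕ.+ l) * fac (l ℕ.+ l))
    ≡⟨ e (+ suc (j ℕ.+ l)) (fac (j ℕ.+ l)) _ (+ suc (l ℕ.+ l)) _ ⟩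
  + suc (j ℕ.+ l) * + suc (l ℕ.+ l) * (fac (j ℕ.+ l) * fac (j ℕ.+ j) * fac (l ℕ.+ l))
    ≡⟨ cong (+ suc (j ℕ.+ l) * + suc (l ℕ.+ l) *_) (F-fac j l) ⟨
  + suc (j ℕ.+ l) * + suc (l ℕ.+ l) * (F j l * cube (fac j * fac l))
    ≡⟨ *-assoc (+ suc (j ℕ.+ l) * + suc (l ℕ.+ l)) (F j l) _ ⟨
  + suc (j ℕ.+ l) * + suc (l ℕ.+ l) * F j l * cube (fac j * fac l) ∎
  where
  open ≡-Reasoning
  e : ∀ a b c d f → a * b * c * (d * f) ≡ a * d * (b * c * f)
  e = solve-∀

module Blocks (q : ℕ) where

  p : ℕ
  p = suc q

  P w : ℤ
  P = + p
  w = fac q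

  -- The product of the i ≤ a p + b prime to p, when p is prime and b < p.
  units : ℕ → ℕ → ℤ
  units zero    b = rise 0ℤ b
  units (suc a) b = units a q * rise (+ (suc a ℕ.* p)) b

  units-+ : ∀ a b → units a b ≡ units a 0 * rise (+ (a ℕ.* p)) b
  units-+ zero    b = sym (*-identityˡ (rise 0ℤ b))
  units-+ (suc a) b = cong (_* rise (+ (suc a ℕ.* p)) b) (sym (*-identityʳ (units a q)))

  -- The multiples of p up to a p contribute `P ^ a * fac a`. The two forms recurse through each
  -- other: a block is filled up to a p + q, and the next factor is the multiple (a + 1) p.
  fac-units₀ : ∀ a → fac (a ℕ.* p) ≡ P ^ a * fac a * units a 0
  fac-units : ∀ a b → fac (a ℕ.* p ℕ.+ b) ≡ P ^ a * fac a * units a b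

  fac-units₀ zero    = refl
  fac-units₀ (suc a) = begin
    fac (p ℕ.+ a ℕ.* p)
      ≡⟨ cong fac (e₁ q (a ℕ.* p)) ⟩
    fac (suc (a ℕ.* p ℕ.+ q))
      ≡⟨ fac-suc (a ℕ.* p ℕ.+ q) ⟩
    + suc (a ℕ.* p ℕ.+ q) * fac (a ℕ.* p ℕ.+ q)
      ≡⟨ cong₂ _*_ (trans (cong +_ (e₂ a q)) (pos-* p (suc a))) (fac-units a q) ⟩
    P * + suc a * (P ^ a * fac a * units a q)
      ≡⟨ e₃ P (+ suc a) (P ^ a) (fac a) (units a q) ⟩
    P * P ^ a * (+ suc a * fac a) * (units a q * 1ℤ)
      ≡⟨ cong (λ x → P * P ^ a * x * (units a q * 1ℤ)) (fac-suc a) ⟨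
    P ^ suc a * fac (suc a) * units (suc a) 0 ∎
    where
    open ≡-Reasoning
    e₁ : ∀ q x → suc q ℕ.+ x ≡ suc (x ℕ.+ q)
    e₁ = ℕ.solve-∀
    e₂ : ∀ a q → suc (a ℕ.* suc q ℕ.+ q) ≡ suc q ℕ.* suc a
    e₂ = ℕ.solve-∀
    e₃ : ∀ x a y b u → x * a * (y * b * u) ≡ x * y * (a * b) * (u * 1ℤ)
    e₃ = solve-∀

  fac-units a b = begin
    fac (a ℕ.* p ℕ.+ b)                                  ≡⟨ fac-+ (a ℕ.* p) b ⟩
    fac (a ℕ.* p) * rise (+ (a ℕ.* p)) b                 ≡⟨ cong (_* rise (+ (a ℕ.* p)) b) (fac-units₀ a) ⟩
    P ^ a * fac a * units a 0 * rise (+ (a ℕ.* p)) b     ≡⟨ *-assoc (P ^ a * fac a) _ _ ⟩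
    P ^ a * fac a * (units a 0 * rise (+ (a ℕ.* p)) b)   ≡⟨ cong (P ^ a * fac a *_) (units-+ a b) ⟨
    P ^ a * fac a * units a b                            ∎
    where open ≡-Reasoning

  ap≈0 : ∀ a → + (a ℕ.* p) ≈ 0ℤ [ P ]
  ap≈0 a = ≈-trans (≡⇒≈ (pos-* a p)) (multiple≈0 (+ a))

  -- Each full block is (p - 1)! modulo p. The value `w` stays symbolic, since its powers cancel by
  -- `pow-diag` and `pow-carry`.
  units-≈ : ∀ a b → units a b ≈ w ^ a * fac b [ P ]
  units-≈ zero    b = ≡⇒≈ (trans (rise-0 b) (sym (*-identityˡ (fac b))))
  units-≈ (suc a) b = begin
    units a q * rise (+ (suc a ℕ.* p)) b   ≈⟨ *-≈ (units-≈ a q) (rise-≈ b (ap≈0 (suc a))) ⟩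
    w ^ a * w * rise 0ℤ b                  ≡⟨ cong₂ _*_ (*-comm (w ^ a) w) (rise-0 b) ⟩
    w ^ suc a * fac b                      ∎
    where open ≈-Reasoning P

  -- d and M record the powers of p and the factorials of the quotients left over after cancellation.
  F-units : ∀ j l r s {N K L t u v} {d M} →
    j ℕ.* p ℕ.+ r ℕ.+ (l ℕ.* p ℕ.+ s) ≡ N ℕ.* p ℕ.+ t →
    j ℕ.* p ℕ.+ r ℕ.+ (j ℕ.* p ℕ.+ r) ≡ K ℕ.* p ℕ.+ u →
    l ℕ.* p ℕ.+ s ℕ.+ (l ℕ.* p ℕ.+ s) ≡ L ℕ.* p ℕ.+ v →
    P ^ N * P ^ K * P ^ L ≡ d * cube (P ^ j * P ^ l) →
    fac N * fac K * fac L ≡ M * cube (fac j * fac l) →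
    F (j ℕ.* p ℕ.+ r) (l ℕ.* p ℕ.+ s) * cube (units j r * units l s)
      ≡ d * M * (units N t * units K u * units L v)
  F-units j l r s {N} {K} {L} {t} {u} {v} {d} {M} k+l≡ k+k≡ l+l≡ powers factorials =
    *-cancelʳ-≡ _ _ Z {{Z-nonZero}} (begin
      F k l′ * cube (units j r * units l s) * Z
        ≡⟨ e₁ (F k l′) (units j r) (units l s) (P ^ j) (P ^ l) (fac j) (fac l) ⟩
      F k l′ * cube (P ^ j * fac j * units j r * (P ^ l * fac l * units l s))
        ≡⟨ cong₂ (λ x y → F k l′ * cube (x * y)) (fac-units j r) (fac-units l s) ⟨
      F k l′ * cube (fac k * fac l′)
        ≡⟨ F-fac k l′ ⟩
      fac (k ℕ.+ l′) * fac (k ℕ.+ k) * fac (l′ ℕ.+ l′)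
        ≡⟨ cong₂ _*_ (cong₂ _*_ (trans (cong fac k+l≡) (fac-units N t)) (trans (cong fac k+k≡) (fac-units K u)))
             (trans (cong fac l+l≡) (fac-units L v)) ⟩
      P ^ N * fac N * units N t * (P ^ K * fac K * units K u) * (P ^ L * fac L * units L v)
        ≡⟨ e₂ (P ^ N) (fac N) (units N t) (P ^ K) (fac K) (units K u) (P ^ L) (fac L) (units L v) ⟩
      P ^ N * P ^ K * P ^ L * (fac N * fac K * fac L) * Y
        ≡⟨ cong₂ (λ x y → x * y * Y) powers factorials ⟩
      d * cube (P ^ j * P ^ l) * (M * cube (fac j * fac l)) * Y
        ≡⟨ e₃ d (cube (P ^ j * P ^ l)) M (cube (fac j * fac l)) Y ⟩
      d * M * Y * Z ∎)
    where
    open ≡-Reasoning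
    k  = j ℕ.* p ℕ.+ r
    l′ = l ℕ.* p ℕ.+ s
    Y Z : ℤ
    Y = units N t * units K u * units L v
    Z = cube (P ^ j * P ^ l) * cube (fac j * fac l)
    P^-nonZero : ∀ a → NonZero (P ^ a)
    P^-nonZero zero    = _
    P^-nonZero (suc a) = i*j≢0 P (P ^ a) {{_}} {{P^-nonZero a}}
    Z-nonZero : NonZero Z
    Z-nonZero = i*j≢0 (cube (P ^ j * P ^ l)) (cube (fac j * fac l))
      {{cube-nonZero (P ^ j * P ^ l) {{i*j≢0 (P ^ j) (P ^ l) {{P^-nonZero j}} {{P^-nonZero l}}}}}} {{facs-nonZero j l}}
    e₁ : ∀ f x y a b c d → f * (x * y * (x * y) * (x * y))
        * (a * b * (a * b) * (a * b) * (c * d * (c * d) * (c * d)))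
      ≡ f * (a * c * x * (b * d * y) * (a * c * x * (b * d * y)) * (a * c * x * (b * d * y)))
    e₁ = solve-∀
    e₂ : ∀ a b c d e f g h i → a * b * c * (d * e * f) * (g * h * i) ≡ a * d * g * (b * e * h) * (c * f * i)
    e₂ = solve-∀
    e₃ : ∀ a b c d y → a * b * (c * d) * y ≡ a * c * y * (b * d)
    e₃ = solve-∀

  -- With both last digits 0 nothing carries: the powers of p cancel, the factorials of the
  -- quotients reassemble `F j l`, and only the parts prime to p are left to compare.
  F-diag : ∀ j l → F (j ℕ.* p) (l ℕ.* p) * cube (units j 0 * units l 0)
    ≡ F j l * (units (j ℕ.+ l) 0 * units (j ℕ.+ j) 0 * units (l ℕ.+ l) 0)
  F-diag j l = begin
    F (j ℕ.* p) (l ℕ.* p) * cube (units j 0 * units l 0)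
      ≡⟨ cong₂ (λ x y → F x y * cube (units j 0 * units l 0)) (ℕ.+-identityʳ (j ℕ.* p)) (ℕ.+-identityʳ (l ℕ.* p)) ⟨
    F (j ℕ.* p ℕ.+ 0) (l ℕ.* p ℕ.+ 0) * cube (units j 0 * units l 0)
      ≡⟨ F-units j l 0 0 {j ℕ.+ l} {j ℕ.+ j} {l ℕ.+ l} {0} {0} {0} {1ℤ} {F j l} (e j l q) (e j j q) (e l l q)
           (trans (pow-diag P j l) (sym (*-identityˡ _))) (sym (F-fac j l)) ⟩
    1ℤ * F j l * (units (j ℕ.+ l) 0 * units (j ℕ.+ j) 0 * units (l ℕ.+ l) 0)
      ≡⟨ cong (_* (units (j ℕ.+ l) 0 * units (j ℕ.+ j) 0 * units (l ℕ.+ l) 0)) (*-identityˡ (F j l)) ⟩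
    F j l * (units (j ℕ.+ l) 0 * units (j ℕ.+ j) 0 * units (l ℕ.+ l) 0) ∎
    where
    open ≡-Reasoning
    e : ∀ j l q → j ℕ.* suc q ℕ.+ 0 ℕ.+ (l ℕ.* suc q ℕ.+ 0) ≡ (j ℕ.+ l) ℕ.* suc q ℕ.+ 0
    e = ℕ.solve-∀

  -- One factor at a time, by suc a ≡ - suc b (mod p) when suc a + suc b = p.
  fac-reflect : ∀ a b → a ℕ.+ b ≡ q → fac a * fac b ≈ -1ℤ ^ a * w [ P ]
  fac-reflect zero    b refl    = ≈-refl
  fac-reflect (suc a) b 1+a+b≡q = begin
    fac (suc a) * fac b
      ≡⟨ cong (_* fac b) (fac-suc a) ⟩
    + suc a * fac a * fac b
      ≡⟨ e₁ (+ suc a) (+ suc b) (fac a) (fac b) ⟩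
    (+ suc a + + suc b) * (fac a * fac b) + - (fac a * (+ suc b * fac b))
      ≡⟨ cong₂ (λ x y → + x * (fac a * fac b) + - (fac a * y))
           (trans (cong suc (trans (ℕ.+-suc a b) 1+a+b≡q)) refl) (sym (fac-suc b)) ⟩
    P * (fac a * fac b) + - (fac a * fac (suc b))
      ≈⟨ +-≈ (≈-trans (≡⇒≈ (*-comm P (fac a * fac b))) (multiple≈0 (fac a * fac b)))
             (≈-trans (≡⇒≈ (neg (fac a * fac (suc b)))) (*-≈ˡ -1ℤ (fac-reflect a (suc b) (trans (ℕ.+-suc a b) 1+a+b≡q)))) ⟩
    0ℤ + -1ℤ * (-1ℤ ^ a * w)
      ≡⟨ e₂ (-1ℤ ^ a) w ⟩
    -1ℤ ^ suc a * w ∎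
    where
    open ≈-Reasoning P
    e₁ : ∀ a b x y → a * x * y ≡ (a + b) * (x * y) + - (x * (b * y))
    e₁ = solve-∀
    neg : ∀ x → - x ≡ -1ℤ * x
    neg = solve-∀
    e₂ : ∀ x w → 0ℤ + -1ℤ * (x * w) ≡ -1ℤ * x * w
    e₂ = solve-∀

  -- The same reflection for arguments adding up to p instead of p - 1; the additional factor
  -- `suc b` is congruent to `- a`.
  fac-reflect′ : ∀ a b → a ℕ.+ b ≡ q → fac a * fac (suc b) ≈ -1ℤ * (-1ℤ ^ a * w * + a) [ P ]
  fac-reflect′ a b a+b≡q = begin
    fac a * fac (suc b)
      ≡⟨ cong (fac a *_) (fac-suc b) ⟩
    fac a * (+ suc b * fac b)
      ≡⟨ e₁ (fac a) (fac b) (+ a) (+ suc b) ⟩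
    (fac a * fac b) * (+ a + + suc b) + -1ℤ * (fac a * fac b * + a)
      ≡⟨ cong (λ x → (fac a * fac b) * + x + -1ℤ * (fac a * fac b * + a)) (trans (ℕ.+-suc a b) (cong suc a+b≡q)) ⟩
    (fac a * fac b) * P + -1ℤ * (fac a * fac b * + a)
      ≈⟨ +-≈ (multiple≈0 (fac a * fac b)) (*-≈ˡ -1ℤ (*-≈ʳ (+ a) (fac-reflect a b a+b≡q))) ⟩
    0ℤ + -1ℤ * (-1ℤ ^ a * w * + a)
      ≡⟨ +-identityˡ _ ⟩
    -1ℤ * (-1ℤ ^ a * w * + a) ∎
    where
    open ≈-Reasoning P
    e₁ : ∀ x y a b → x * (b * y) ≡ x * y * (a + b) + -1ℤ * (x * y * a)
    e₁ = solve-∀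

  units-product : ∀ N K L t u v → units N t * units K u * units L v
    ≈ w ^ N * w ^ K * w ^ L * (fac t * fac u * fac v) [ P ]
  units-product N K L t u v = ≈-trans (*-≈ (*-≈ (units-≈ N t) (units-≈ K u)) (units-≈ L v))
    (≡⇒≈ (e (w ^ N) (fac t) (w ^ K) (fac u) (w ^ L) (fac v)))
    where
    e : ∀ a b c d f g → a * b * (c * d) * (f * g) ≡ a * c * f * (b * d * g)
    e = solve-∀

  units-cube : ∀ j l r s → cube (units j r * units l s) ≈ cube (w ^ j * w ^ l) * cube (fac r * fac s) [ P ]
  units-cube j l r s = ≈-trans (cube-≈ (*-≈ (units-≈ j r) (units-≈ l s)))
    (≡⇒≈ (e (w ^ j) (fac r) (w ^ l) (fac s)))
    where
    e : ∀ a b c d → a * b * (c * d) * (a * b * (c * d)) * (a * b * (c * d))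
      ≡ a * c * (a * c) * (a * c) * (b * d * (b * d) * (b * d))
    e = solve-∀

  module _ (p-prime : Prime p) where

    unit-fac< : ∀ {a} → a ℕ.≤ q → Unit P (fac a)
    unit-fac< {a} a≤q = unit-fac a p-prime (ℕ.s≤s a≤q)

    unit-w : Unit P w
    unit-w = unit-fac< ℕ.≤-refl

    unit-units : ∀ a {b} → b ℕ.≤ q → Unit P (units a b)
    unit-units a {b} b≤q = unit-≈ (≈-sym (units-≈ a b)) (unit-* (unit-^ a unit-w) (unit-fac< b≤q))

    unit-units-cube : ∀ j l {r s} → r ℕ.≤ q → s ℕ.≤ q → Unit P (cube (units j r * units l s))
    unit-units-cube j l r≤q s≤q = unit-cube (unit-* (unit-units j r≤q) (unit-units l s≤q))

-- Fermat's little theorem and Euler numbers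

binom : ℕ → ℕ → ℤ
binom k l = + ((k ℕ.+ l) C k)

binom-fac : ∀ k l → binom k l * (fac k * fac l) ≡ fac (k ℕ.+ l)
binom-fac k l = begin
  binom k l * (fac k * fac l)              ≡⟨ cong (binom k l *_) (pos-* (k !) (l !)) ⟨
  binom k l * + (k ! ℕ.* l !)              ≡⟨ pos-* ((k ℕ.+ l) C k) (k ! ℕ.* l !) ⟨
  + (((k ℕ.+ l) C k) ℕ.* (k ! ℕ.* l !))      ≡⟨ cong +_ (C*!*! k l) ⟩
  fac (k ℕ.+ l)                            ∎
  where open ≡-Reasoning

fac*fac-nonZero : ∀ k l → NonZero (fac k * fac l)
fac*fac-nonZero k l = i*j≢0 (fac k) (fac l) {{fac-nonZero k}} {{fac-nonZero l}}

binom-sucˡ : ∀ k l → + suc k * binom (suc k) l ≡ + suc (k ℕ.+ l) * binom k l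
binom-sucˡ k l = *-cancelʳ-≡ _ _ (fac k * fac l) {{fac*fac-nonZero k l}} (begin
  + suc k * binom (suc k) l * (fac k * fac l)          ≡⟨ e (+ suc k) (binom (suc k) l) (fac k) (fac l) ⟩
  binom (suc k) l * (+ suc k * fac k * fac l)          ≡⟨ cong (λ x → binom (suc k) l * (x * fac l)) (fac-suc k) ⟨
  binom (suc k) l * (fac (suc k) * fac l)              ≡⟨ trans (binom-fac (suc k) l) (fac-suc (k ℕ.+ l)) ⟩
  + suc (k ℕ.+ l) * fac (k ℕ.+ l)                      ≡⟨ cong (+ suc (k ℕ.+ l) *_) (binom-fac k l) ⟨
  + suc (k ℕ.+ l) * (binom k l * (fac k * fac l))      ≡⟨ *-assoc (+ suc (k ℕ.+ l)) (binom k l) _ ⟨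
  + suc (k ℕ.+ l) * binom k l * (fac k * fac l)        ∎)
  where
  open ≡-Reasoning
  e : ∀ s b x y → s * b * (x * y) ≡ b * (s * x * y)
  e = solve-∀

binom-sym : ∀ k l → binom k l ≡ binom l k
binom-sym k l = *-cancelʳ-≡ _ _ (fac k * fac l) {{fac*fac-nonZero k l}} (begin
  binom k l * (fac k * fac l)  ≡⟨ binom-fac k l ⟩
  fac (k ℕ.+ l)                ≡⟨ cong fac (ℕ.+-comm k l) ⟩
  fac (l ℕ.+ k)                ≡⟨ binom-fac l k ⟨
  binom l k * (fac l * fac k)  ≡⟨ cong (binom l k *_) (*-comm (fac l) (fac k)) ⟩
  binom l k * (fac k * fac l)  ∎)
  where open ≡-Reasoning

binom-sucʳ : ∀ k l → + suc l * binom k (suc l) ≡ + suc (k ℕ.+ l) * binom k l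
binom-sucʳ k l = trans (cong (+ suc l *_) (binom-sym k (suc l)))
  (trans (binom-sucˡ l k) (cong₂ (λ x y → + suc x * y) (ℕ.+-comm l k) (binom-sym l k)))

-- Pascal's rule; multiplying by n + 1 = k + l lets binom-sucˡ and binom-sucʳ
-- absorb the weights, so the boundary terms need no separate treatment.
conv-pascal : ∀ (g : ℕ → ℕ → ℤ) n → conv (λ k l → binom k l * g k l) (suc n)
  ≡ conv (λ k l → binom k l * g (suc k) l) n + conv (λ k l → binom k l * g k (suc l)) n
conv-pascal g n = *-cancelˡ-≡ (+ suc n) _ _ (begin
  + suc n * conv (λ k l → binom k l * g k l) (suc n)
    ≡⟨ conv-* (+ suc n) (λ k l → binom k l * g k l) (suc n) ⟨
  conv (λ k l → + suc n * (binom k l * g k l)) (suc n)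
    ≡⟨ conv-cong (suc n) (λ k l k+l≡n → trans (cong (λ x → + x * (binom k l * g k l)) (sym k+l≡n))
         (e₁ (+ k) (+ l) (binom k l) (g k l))) ⟩
  conv (λ k l → f₁ k l + f₂ k l) (suc n)
    ≡⟨ conv-+ f₁ f₂ (suc n) ⟩
  conv f₁ (suc n) + conv f₂ (suc n)
    ≡⟨ cong₂ _+_ (+-identityˡ (conv (λ k l → f₁ (suc k) l) n)) (trans (conv-last f₂ n) (+-identityʳ (conv (λ k l → f₂ k (suc l)) n))) ⟩
  conv (λ k l → + suc k * binom (suc k) l * g (suc k) l) n + conv (λ k l → + suc l * binom k (suc l) * g k (suc l)) n
    ≡⟨ cong₂ _+_
         (conv-cong n λ k l k+l≡n → trans (cong (_* g (suc k) l)
           (trans (binom-sucˡ k l) (cong (λ x → + suc x * binom k l) k+l≡n))) (*-assoc (+ suc n) (binom k l) _))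
         (conv-cong n λ k l k+l≡n → trans (cong (_* g k (suc l))
           (trans (binom-sucʳ k l) (cong (λ x → + suc x * binom k l) k+l≡n))) (*-assoc (+ suc n) (binom k l) _)) ⟩
  conv (λ k l → + suc n * (binom k l * g (suc k) l)) n + conv (λ k l → + suc n * (binom k l * g k (suc l))) n
    ≡⟨ cong₂ _+_ (conv-* (+ suc n) (λ k l → binom k l * g (suc k) l) n) (conv-* (+ suc n) (λ k l → binom k l * g k (suc l)) n) ⟩
  + suc n * conv (λ k l → binom k l * g (suc k) l) n + + suc n * conv (λ k l → binom k l * g k (suc l)) n
    ≡⟨ *-distribˡ-+ (+ suc n) (conv (λ k l → binom k l * g (suc k) l) n) _ ⟨
  + suc n * (conv (λ k l → binom k l * g (suc k) l) n + conv (λ k l → binom k l * g k (suc l)) n) ∎)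
  where
  open ≡-Reasoning
  f₁ f₂ : ℕ → ℕ → ℤ
  f₁ k l = + k * binom k l * g k l
  f₂ k l = + l * binom k l * g k l
  e₁ : ∀ k l b x → (k + l) * (b * x) ≡ k * b * x + l * b * x
  e₁ = solve-∀

-- Umbral calculus: with X the shift of sequences, shift+ t is the operator X + t.
shift+ : ℤ → (ℕ → ℤ) → ℕ → ℤ
shift+ t f i = f (suc i) + t * f i

shift+^ : ℤ → ℕ → (ℕ → ℤ) → ℕ → ℤ
shift+^ t zero    f = f
shift+^ t (suc m) f = shift+ t (shift+^ t m f)

-- The binomial theorem for the commuting operators X and t, with `conv-pascal` as its inductive
-- step.
shift+^-expand : ∀ t m f i → shift+^ t m f i ≡ conv (λ k l → binom k l * (t ^ l * f (i ℕ.+ k))) m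
shift+^-expand t zero    f i = trans (cong f (sym (ℕ.+-identityʳ i))) (e (f (i ℕ.+ 0)))
  where
  e : ∀ x → x ≡ 1ℤ * (1ℤ * x)
  e = solve-∀
shift+^-expand t (suc m) f i = begin
  shift+^ t m f (suc i) + t * shift+^ t m f i
    ≡⟨ cong₂ (λ x y → x + t * y) (shift+^-expand t m f (suc i)) (shift+^-expand t m f i) ⟩
  conv (λ k l → binom k l * (t ^ l * f (suc i ℕ.+ k))) m + t * conv (λ k l → binom k l * (t ^ l * f (i ℕ.+ k))) m
    ≡⟨ cong₂ _+_
         (conv-cong m λ k l _ → cong (λ x → binom k l * (t ^ l * f x)) (sym (ℕ.+-suc i k)))
         (trans (sym (conv-* t (λ k l → binom k l * (t ^ l * f (i ℕ.+ k))) m))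
           (conv-cong m λ k l _ → e t (binom k l) (t ^ l) (f (i ℕ.+ k)))) ⟩
  conv (λ k l → binom k l * (t ^ l * f (i ℕ.+ suc k))) m + conv (λ k l → binom k l * (t ^ suc l * f (i ℕ.+ k))) m
    ≡⟨ conv-pascal (λ k l → t ^ l * f (i ℕ.+ k)) m ⟨
  conv (λ k l → binom k l * (t ^ l * f (i ℕ.+ k))) (suc m) ∎
  where
  open ≡-Reasoning
  e : ∀ t b x y → t * (b * (x * y)) ≡ b * (t * x * y)
  e = solve-∀

-- A geometric sequence is an eigenvector of the shift with eigenvalue `a`. Compared with
-- `shift+^-expand`, this is the ordinary binomial theorem that Fermat's theorem uses.
shift+^-geometric : ∀ t a m i → shift+^ t m (a ^_) i ≡ (a + t) ^ m * a ^ i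
shift+^-geometric t a zero    i = sym (*-identityˡ (a ^ i))
shift+^-geometric t a (suc m) i =
  trans (cong₂ (λ x y → x + t * y) (shift+^-geometric t a m (suc i)) (shift+^-geometric t a m i))
        (e a t ((a + t) ^ m) (a ^ i))
  where
  e : ∀ a t x y → x * (a * y) + t * (x * y) ≡ (a + t) * x * y
  e = solve-∀

-- Modulo a divisor of `t` the operator X + t is just X; applied to `eulerPoly` at p, this leaves a
-- single Euler number.
shift+^-≈ : ∀ {t m} n f i → t ≈ 0ℤ [ m ] → shift+^ t n f i ≈ f (i ℕ.+ n) [ m ]
shift+^-≈ zero    f i t≈0 = ≡⇒≈ (cong f (sym (ℕ.+-identityʳ i)))
shift+^-≈ {t} {m} (suc n) f i t≈0 = begin
  shift+^ t n f (suc i) + t * shift+^ t n f i   ≈⟨ +-≈ (shift+^-≈ n f (suc i) t≈0) (*-≈ʳ (shift+^ t n f i) t≈0) ⟩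
  f (suc i ℕ.+ n) + 0ℤ                          ≡⟨ trans (+-identityʳ _) (cong f (sym (ℕ.+-suc i n))) ⟩
  f (i ℕ.+ suc n)                               ∎
  where open ≈-Reasoning m

shift+^-cong : ∀ t m {f g} → (∀ i → f i ≡ g i) → ∀ i → shift+^ t m f i ≡ shift+^ t m g i
shift+^-cong t zero    f≡g i = f≡g i
shift+^-cong t (suc m) f≡g i =
  cong₂ (λ x y → x + t * y) (shift+^-cong t m f≡g (suc i)) (shift+^-cong t m f≡g i)

shift+^-comm : ∀ s m u f i → shift+^ s m (shift+ u f) i ≡ shift+ u (shift+^ s m f) i
shift+^-comm s zero    u f i = refl
shift+^-comm s (suc m) u f i =
  trans (cong₂ (λ x y → x + s * y) (shift+^-comm s m u f (suc i)) (shift+^-comm s m u f i))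
        (e s u (g (suc (suc i))) (g (suc i)) (g i))
  where
  g : ℕ → ℤ
  g = shift+^ s m f
  e : ∀ s u x y z → x + u * y + s * (y + u * z) ≡ x + s * y + u * (y + s * z)
  e = solve-∀

module Fermat (x : ℕ) (p-prime : Prime (suc (suc x))) where

  p = suc (suc x)

  binom≈0 : ∀ k l → k ℕ.+ l ≡ x → binom (suc k) (suc l) ≈ 0ℤ [ + p ]
  binom≈0 k l k+l≡x = unit-cancelʳ
    (unit-* (unit-fac (suc k) p-prime (ℕ.s≤s (ℕ.s≤s (subst (k ℕ.≤_) k+l≡x (ℕ.m≤m+n k l)))))
            (unit-fac (suc l) p-prime (ℕ.s≤s (ℕ.s≤s (subst (l ℕ.≤_) k+l≡x (ℕ.m≤n+m l k))))))
    (begin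
      binom (suc k) (suc l) * (fac (suc k) * fac (suc l))   ≡⟨ binom-fac (suc k) (suc l) ⟩
      fac (suc k ℕ.+ suc l)                                 ≡⟨ cong fac (cong suc (trans (ℕ.+-suc k l) (cong suc k+l≡x))) ⟩
      fac (suc (suc x))                                     ≡⟨ trans (fac-suc (suc x)) (*-comm (+ p) (fac (suc x))) ⟩
      fac (suc x) * + p                                     ≈⟨ multiple≈0 (fac (suc x)) ⟩
      0ℤ                                                    ≡⟨⟩
      0ℤ * (fac (suc k) * fac (suc l))                      ∎)
    where open ≈-Reasoning (+ p)

  -- All inner binomial coefficients vanish modulo p, so only the two end terms of the expansion
  -- survive.
  fermat-suc : ∀ a → (a + 1ℤ) ^ p ≈ 1ℤ + a ^ p [ + p ]
  fermat-suc a = begin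
    (a + 1ℤ) ^ p
      ≡⟨ trans (sym (*-identityʳ _)) (sym (shift+^-geometric 1ℤ a p 0)) ⟩
    shift+^ 1ℤ p (a ^_) 0
      ≡⟨ shift+^-expand 1ℤ p (a ^_) 0 ⟩
    conv g p
      ≡⟨⟩
    g 0 p + conv (λ k l → g (suc k) l) (suc x)
      ≡⟨ cong₂ _+_ (refl {x = g 0 p}) (conv-last (λ k l → g (suc k) l) x) ⟩
    g 0 p + (conv (λ k l → g (suc k) (suc l)) x + g p 0)
      ≈⟨ +-≈ (≡⇒≈ g-first) (+-≈ (≈-trans (conv-≈ x λ k l k+l≡x → *-≈ʳ (1ℤ ^ suc l * a ^ suc k) (binom≈0 k l k+l≡x)) (≡⇒≈ (conv-0 x)))
           (≡⇒≈ g-last)) ⟩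
    1ℤ + (0ℤ + a ^ p)
      ≡⟨ cong (λ z → 1ℤ + z) (+-identityˡ (a ^ p)) ⟩
    1ℤ + a ^ p ∎
    where
    open ≈-Reasoning (+ p)
    g : ℕ → ℕ → ℤ
    g k l = binom k l * (1ℤ ^ l * a ^ k)
    g-first : g 0 p ≡ 1ℤ
    g-first = trans (*-identityˡ _) (trans (*-identityʳ _) (^-zeroˡ p))
    g-last : g p 0 ≡ a ^ p
    g-last = trans (cong₂ (λ y z → + y * z) (trans (cong (_C p) (ℕ.+-identityʳ p)) (nCn≡1 p)) (*-identityˡ (a ^ p)))
      (*-identityˡ (a ^ p))

  fermat : ∀ a → (+ a) ^ p ≈ + a [ + p ]
  fermat zero    = ≈-refl
  fermat (suc a) = begin
    (+ suc a) ^ p      ≡⟨ cong (_^ p) (+-comm 1ℤ (+ a)) ⟩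
    (+ a + 1ℤ) ^ p     ≈⟨ fermat-suc (+ a) ⟩
    1ℤ + (+ a) ^ p     ≈⟨ +-≈ (≈-refl {1ℤ}) (fermat a) ⟩
    + suc a            ∎
    where open ≈-Reasoning (+ p)

  fermat′ : ∀ {a} → suc a ℕ.< p → (+ suc a) ^ suc x ≈ 1ℤ [ + p ]
  fermat′ {a} a<p = unit-cancelʳ (unit-<prime p-prime a<p) (begin
    (+ suc a) ^ suc x * + suc a   ≡⟨ *-comm ((+ suc a) ^ suc x) (+ suc a) ⟩
    (+ suc a) ^ p                 ≈⟨ fermat (suc a) ⟩
    + suc a                       ≡⟨ *-identityˡ (+ suc a) ⟨
    1ℤ * + suc a                  ∎)
    where open ≈-Reasoning (+ p)

-- Euler numbers as an umbral functional, and alternating power sums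

parity : ∀ n → ∃ λ k → n ≡ k ℕ.+ k ⊎ n ≡ suc (k ℕ.+ k)
parity zero = 0 , inj₁ refl
parity (suc n) with parity n
... | k , inj₁ n≡2k   = k , inj₂ (cong suc n≡2k)
... | k , inj₂ n≡2k+1 = suc k , inj₁ (trans (cong suc n≡2k+1) (cong suc (sym (ℕ.+-suc k k))))

[-1]^[n+n]≡1 : ∀ n → -1ℤ ^ (n ℕ.+ n) ≡ 1ℤ
[-1]^[n+n]≡1 n = trans (^-distribˡ-+-* -1ℤ n n) ([-1]^n*[-1]^n≡1 n)

2*≡+ : ∀ n → 2 ℕ.* n ≡ n ℕ.+ n
2*≡+ n = cong (n ℕ.+_) (ℕ.+-identityʳ n)

sum≡conv : ∀ (f : ℕ → ℤ) n → ∑[ k ≤ n ] f (toℕ k) ≡ conv (λ k _ → f k) n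
sum≡conv f zero    = +-identityʳ (f 0)
sum≡conv f (suc n) = cong₂ _+_ (refl {x = f 0}) (sum≡conv (λ k → f (suc k)) n)

conv-even : ∀ (f : ℕ → ℤ) n → (∀ k → f (suc (k ℕ.+ k)) ≡ 0ℤ) →
  conv (λ k _ → f k) (n ℕ.+ n) ≡ conv (λ k _ → f (k ℕ.+ k)) n
conv-even f zero    odd≡0 = refl
conv-even f (suc n) odd≡0 = cong₂ _+_ (refl {x = f 0}) (begin
  conv (λ k _ → f (suc k)) (n ℕ.+ suc n)
    ≡⟨ cong (conv (λ k _ → f (suc k))) (ℕ.+-suc n n) ⟩
  f 1 + conv (λ k _ → f (suc (suc k))) (n ℕ.+ n)
    ≡⟨ cong₂ _+_ (odd≡0 0) (conv-even (λ k → f (suc (suc k))) n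
         (λ k → trans (cong (λ x → f (suc (suc x))) (sym (ℕ.+-suc k k))) (odd≡0 (suc k)))) ⟩
  0ℤ + conv (λ k _ → f (suc (suc (k ℕ.+ k)))) n
    ≡⟨ +-identityˡ _ ⟩
  conv (λ k _ → f (suc (suc (k ℕ.+ k)))) n
    ≡⟨ conv-cong n (λ k _ _ → cong (λ x → f (suc x)) (sym (ℕ.+-suc k k))) ⟩
  conv (λ k _ → f (suc k ℕ.+ suc k)) n ∎)
  where open ≡-Reasoning

module Euler {E : ℕ → ℤ} (isE : IsEuler E) where
  open IsEuler isE

  E-odd′ : ∀ k → E (suc (k ℕ.+ k)) ≡ 0ℤ
  E-odd′ k = trans (cong E (trans (sym (ℕ.+-suc k k)) (cong (k ℕ.+_) (sym (cong suc (ℕ.+-identityʳ k))))))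
    (E-odd (suc k) (ℕ.s≤s ℕ.z≤n))

  E-sign : ∀ k → -1ℤ ^ k * E k ≡ E k
  E-sign k with parity k
  ... | j , inj₁ refl = trans (cong (_* E (j ℕ.+ j)) ([-1]^[n+n]≡1 j)) (*-identityˡ _)
  ... | j , inj₂ refl = trans (cong (-1ℤ ^ suc (j ℕ.+ j) *_) (E-odd′ j))
    (trans (*-zeroʳ (-1ℤ ^ suc (j ℕ.+ j))) (sym (E-odd′ j)))

  -- This is `E-sum` with the vanishing odd terms put back, so that the whole binomial expansion of
  -- (X + 1)^(2n+2) appears.
  shift+1-even : ∀ n → shift+^ 1ℤ (suc n ℕ.+ suc n) E 0 ≡ 0ℤ
  shift+1-even n = begin
    shift+^ 1ℤ (N ℕ.+ N) E 0
      ≡⟨ shift+^-expand 1ℤ (N ℕ.+ N) E 0 ⟩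
    conv (λ k l → binom k l * (1ℤ ^ l * E k)) (N ℕ.+ N)
      ≡⟨ conv-cong (N ℕ.+ N) (λ k l k+l≡ → cong₂ (λ x y → + (x C k) * y) k+l≡
           (trans (cong (_* E k) (^-zeroˡ l)) (*-identityˡ (E k)))) ⟩
    conv (λ k _ → + ((N ℕ.+ N) C k) * E k) (N ℕ.+ N)
      ≡⟨ conv-even (λ k → + ((N ℕ.+ N) C k) * E k) N
           (λ k → trans (cong (+ ((N ℕ.+ N) C suc (k ℕ.+ k)) *_) (E-odd′ k)) (*-zeroʳ (+ ((N ℕ.+ N) C suc (k ℕ.+ k))))) ⟩
    conv (λ k _ → + ((N ℕ.+ N) C (k ℕ.+ k)) * E (k ℕ.+ k)) N
      ≡⟨ conv-cong N (λ k _ _ → sym (cong₂ (λ x y → + (x C y) * E y) (2*≡+ N) (2*≡+ k))) ⟩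
    conv (λ k _ → + ((2 ℕ.* N) C (2 ℕ.* k)) * E (2 ℕ.* k)) N
      ≡⟨ sum≡conv (λ k → + ((2 ℕ.* N) C (2 ℕ.* k)) * E (2 ℕ.* k)) N ⟨
    ∑[ k ≤ N ] (+ ((2 ℕ.* N) C (2 ℕ.* toℕ k)) * E (2 ℕ.* toℕ k))
      ≡⟨ E-sum N (ℕ.s≤s ℕ.z≤n) ⟩
    0ℤ ∎
    where
    open ≡-Reasoning
    N = suc n

  -- Since odd Euler numbers vanish, the functional X^k ↦ E k is invariant under X ↦ -X, which
  -- exchanges X - 1 and X + 1 up to sign.
  shift-1 : ∀ j → shift+^ -1ℤ j E 0 ≡ -1ℤ ^ j * shift+^ 1ℤ j E 0
  shift-1 j = begin
    shift+^ -1ℤ j E 0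
      ≡⟨ shift+^-expand -1ℤ j E 0 ⟩
    conv (λ k l → binom k l * (-1ℤ ^ l * E k)) j
      ≡⟨ conv-cong j (λ k l k+l≡j → term k l k+l≡j) ⟩
    conv (λ k l → -1ℤ ^ j * (binom k l * (1ℤ ^ l * E k))) j
      ≡⟨ conv-* (-1ℤ ^ j) (λ k l → binom k l * (1ℤ ^ l * E k)) j ⟩
    -1ℤ ^ j * conv (λ k l → binom k l * (1ℤ ^ l * E k)) j
      ≡⟨ cong (-1ℤ ^ j *_) (shift+^-expand 1ℤ j E 0) ⟨
    -1ℤ ^ j * shift+^ 1ℤ j E 0 ∎
    where
    open ≡-Reasoning
    e : ∀ b x y z → b * (x * (y * z)) ≡ y * x * (b * (1ℤ * z))
    e = solve-∀
    term : ∀ k l → k ℕ.+ l ≡ j → binom k l * (-1ℤ ^ l * E k) ≡ -1ℤ ^ j * (binom k l * (1ℤ ^ l * E k))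
    term k l refl = begin
      binom k l * (-1ℤ ^ l * E k)
        ≡⟨ cong (λ x → binom k l * (-1ℤ ^ l * x)) (E-sign k) ⟨
      binom k l * (-1ℤ ^ l * (-1ℤ ^ k * E k))
        ≡⟨ e (binom k l) (-1ℤ ^ l) (-1ℤ ^ k) (E k) ⟩
      -1ℤ ^ k * -1ℤ ^ l * (binom k l * (1ℤ * E k))
        ≡⟨ cong₂ (λ x y → x * (binom k l * (y * E k))) (^-distribˡ-+-* -1ℤ k l) (^-zeroˡ l) ⟨
      -1ℤ ^ (k ℕ.+ l) * (binom k l * (1ℤ ^ l * E k)) ∎

  2δ : ℕ → ℤ
  2δ zero    = + 2
  2δ (suc _) = 0ℤ

  -- With L the linear functional X^k ↦ E k, this says L ((X + 1)^j + (X - 1)^j) = 2 δ_{j0}.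
  shift±1 : ∀ j → shift+^ 1ℤ j E 0 + shift+^ -1ℤ j E 0 ≡ 2δ j
  shift±1 j with parity j
  ... | zero  , inj₁ refl = cong (λ x → x + x) E-zero
  ... | suc k , inj₁ refl = trans (cong₂ (λ x y → x + y) (shift+1-even k)
    (trans (shift-1 (suc k ℕ.+ suc k)) (trans (cong (-1ℤ ^ (suc k ℕ.+ suc k) *_) (shift+1-even k))
      (*-zeroʳ (-1ℤ ^ (suc k ℕ.+ suc k)))))) refl
  ... | k , inj₂ refl = trans (cong₂ _+_ (refl {x = B}) (trans (shift-1 (suc (k ℕ.+ k)))
      (cong (λ x → -1ℤ * x * B) ([-1]^[n+n]≡1 k)))) (e B)
    where
    B : ℤ
    B = shift+^ 1ℤ (suc (k ℕ.+ k)) E 0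
    e : ∀ x → x + -1ℤ * 1ℤ * x ≡ 0ℤ
    e = solve-∀

  -- Only `j = 0` is wanted, but the induction on `m` needs every `j`: splitting X ± 1 + t as (X ±
  -- 1) + t either raises `j`, where the right side is 0, or multiplies by `t`.
  shift±1+t : ∀ t m j → shift+^ 1ℤ j (shift+^ (1ℤ + t) m E) 0 + shift+^ -1ℤ j (shift+^ (-1ℤ + t) m E) 0
    ≡ 2δ j * t ^ m
  shift±1+t t zero    j = trans (shift±1 j) (sym (*-identityʳ (2δ j)))
  shift±1+t t (suc m) j = begin
    shift+^ 1ℤ j (shift+ (1ℤ + t) A₊) 0 + shift+^ -1ℤ j (shift+ (-1ℤ + t) A₋) 0
      ≡⟨ cong₂ _+_ (shift+^-comm 1ℤ j (1ℤ + t) A₊ 0) (shift+^-comm -1ℤ j (-1ℤ + t) A₋ 0) ⟩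
    shift+ (1ℤ + t) B₊ 0 + shift+ (-1ℤ + t) B₋ 0
      ≡⟨ e t (B₊ 1) (B₊ 0) (B₋ 1) (B₋ 0) ⟩
    shift+ 1ℤ B₊ 0 + shift+ -1ℤ B₋ 0 + t * (B₊ 0 + B₋ 0)
      ≡⟨ cong₂ (λ x y → x + t * y) (shift±1+t t m (suc j)) (shift±1+t t m j) ⟩
    0ℤ * t ^ m + t * (2δ j * t ^ m)
      ≡⟨ e′ t (2δ j) (t ^ m) ⟩
    2δ j * t ^ suc m ∎
    where
    open ≡-Reasoning
    A₊ A₋ B₊ B₋ : ℕ → ℤ
    A₊ = shift+^ (1ℤ + t) m E
    A₋ = shift+^ (-1ℤ + t) m E
    B₊ = shift+^ 1ℤ j A₊
    B₋ = shift+^ -1ℤ j A₋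
    e : ∀ t a b c d → a + (1ℤ + t) * b + (c + (-1ℤ + t) * d) ≡ a + 1ℤ * b + (c + -1ℤ * d) + t * (b + d)
    e = solve-∀
    e′ : ∀ t x y → 0ℤ * y + t * (x * y) ≡ x * (t * y)
    e′ = solve-∀

  -- 2^m times the Euler polynomial E_m at (t + 1)/2.
  eulerPoly : ℕ → ℤ → ℤ
  eulerPoly m t = shift+^ t m E 0

  eulerPoly-sum : ∀ m t → eulerPoly m (1ℤ + t) + eulerPoly m (-1ℤ + t) ≡ + 2 * t ^ m
  eulerPoly-sum m t = shift±1+t t m 0

  -- `eulerPoly-sum` at the even points 2, 4, ... telescopes under alternating signs. With h terms
  -- the upper end is the argument 2h + 1, which for p = 2h + 1 is p itself.
  alternating-sum : ∀ m n → conv (λ k _ → -1ℤ ^ suc k * (+ 2 * (+ suc k + + suc k) ^ m)) n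
    ≡ - eulerPoly m 1ℤ + -1ℤ ^ suc n * eulerPoly m (1ℤ + (+ suc n + + suc n))
  alternating-sum m zero    = begin
    -1ℤ * 1ℤ * (+ 2 * (+ 2) ^ m)                           ≡⟨ cong (-1ℤ * 1ℤ *_) (eulerPoly-sum m (+ 2)) ⟨
    -1ℤ * 1ℤ * (eulerPoly m (+ 3) + eulerPoly m 1ℤ)        ≡⟨ e (eulerPoly m (+ 3)) (eulerPoly m 1ℤ) ⟩
    - eulerPoly m 1ℤ + -1ℤ * 1ℤ * eulerPoly m (+ 3)        ∎
    where
    open ≡-Reasoning
    e : ∀ x y → -1ℤ * 1ℤ * (x + y) ≡ - y + -1ℤ * 1ℤ * x
    e = solve-∀
  alternating-sum m (suc n) = begin
    conv f (suc n)
      ≡⟨ conv-last f n ⟩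
    conv f n + -1ℤ ^ suc (suc n) * (+ 2 * t ^ m)
      ≡⟨ cong₂ (λ x y → x + -1ℤ ^ suc (suc n) * y) (alternating-sum m n) (sym (eulerPoly-sum m t)) ⟩
    - A 1ℤ + -1ℤ ^ suc n * A (1ℤ + (+ suc n + + suc n)) + -1ℤ ^ suc (suc n) * (A (1ℤ + t) + A (-1ℤ + t))
      ≡⟨ cong (λ x → - A 1ℤ + -1ℤ ^ suc n * A x + -1ℤ ^ suc (suc n) * (A (1ℤ + t) + A (-1ℤ + t))) (e (+ suc n)) ⟩
    - A 1ℤ + -1ℤ ^ suc n * A (-1ℤ + t) + -1ℤ ^ suc (suc n) * (A (1ℤ + t) + A (-1ℤ + t))
      ≡⟨ e′ (A 1ℤ) (-1ℤ ^ suc n) (A (-1ℤ + t)) (A (1ℤ + t)) ⟩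
    - A 1ℤ + -1ℤ ^ suc (suc n) * A (1ℤ + t) ∎
    where
    open ≡-Reasoning
    A : ℤ → ℤ
    A = eulerPoly m
    f : ℕ → ℕ → ℤ
    f k _ = -1ℤ ^ suc k * (+ 2 * (+ suc k + + suc k) ^ m)
    t : ℤ
    t = + suc (suc n) + + suc (suc n)
    e : ∀ n → 1ℤ + (n + n) ≡ -1ℤ + (1ℤ + n + (1ℤ + n))
    e = solve-∀
    e′ : ∀ a s x y → - a + s * x + -1ℤ * s * (y + x) ≡ - a + -1ℤ * s * y
    e′ = solve-∀

-- The sequence at multiples of p

^-distribʳ-* : ∀ a b n → (a * b) ^ n ≡ a ^ n * b ^ n
^-distribʳ-* a b zero    = refl
^-distribʳ-* a b (suc n) = trans (cong (a * b *_) (^-distribʳ-* a b n)) (e a b (a ^ n) (b ^ n))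
  where
  e : ∀ a b x y → a * b * (x * y) ≡ a * x * (b * y)
  e = solve-∀

-- Writing p = 2 (h′ + 1) + 1 makes h = (p - 1)/2 and m = p - 3 computable without subtraction; `m`
-- is visibly even.
module Odd (h′ : ℕ) (p-prime : Prime (suc (suc h′ ℕ.+ suc h′))) where

  h q m : ℕ
  h = suc h′
  q = h ℕ.+ h
  m = h′ ℕ.+ h′

  open Blocks q
  open Fermat (h′ ℕ.+ suc h′) p-prime using (fermat′)

  P³ : ℤ
  P³ = P * P * P

  P≈0 : P ≈ 0ℤ [ P ]
  P≈0 = ≈-trans (≡⇒≈ (sym (*-identityˡ P))) (multiple≈0 1ℤ)

  inverse-square : ∀ {a} → suc a ℕ.< p → + suc a * + suc a * (+ suc a) ^ m ≈ 1ℤ [ P ]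
  inverse-square {a} a<p = ≈-trans
    (≡⇒≈ (trans (*-assoc (+ suc a) (+ suc a) _) (cong (λ x → (+ suc a) ^ suc x) (sym (ℕ.+-suc h′ h′)))))
    (fermat′ a<p)

  -- F-sucʳ propagates the factor 2 L + 1 = (2 l + 1) p that appears at L = l p + h.
  F≈0 : ∀ k l s → s ℕ.≤ h′ → F k (l ℕ.* p ℕ.+ suc (s ℕ.+ h)) ≈ 0ℤ [ P ]
  F≈0-step : ∀ k l s → s ℕ.≤ h′ → let L = l ℕ.* p ℕ.+ (s ℕ.+ h) in
    + 2 * + suc (k ℕ.+ L) * (+ 2 * + L + 1ℤ) * F k L ≈ 0ℤ [ P ]

  F≈0 k l s s≤h′ = unit-cancelʳ (unit-* unit-L+1 unit-L+1) (begin
    F k (l ℕ.* p ℕ.+ suc (s ℕ.+ h)) * (+ suc L * + suc L)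
      ≡⟨ cong (λ x → F k x * (+ suc L * + suc L)) (ℕ.+-suc (l ℕ.* p) (s ℕ.+ h)) ⟩
    F k (suc L) * (+ suc L * + suc L)
      ≡⟨ trans (*-comm (F k (suc L)) _) (F-sucʳ k L) ⟩
    + 2 * + suc (k ℕ.+ L) * (+ 2 * + L + 1ℤ) * F k L
      ≈⟨ F≈0-step k l s s≤h′ ⟩
    0ℤ
      ≡⟨⟩
    0ℤ * (+ suc L * + suc L) ∎)
    where
    open ≈-Reasoning P
    L = l ℕ.* p ℕ.+ (s ℕ.+ h)
    s+h<q : s ℕ.+ h ℕ.< q
    s+h<q = ℕ.+-monoˡ-≤ h (ℕ.s≤s s≤h′)
    unit-L+1 : Unit P (+ suc L)
    unit-L+1 = unit-≈ (≈-sym (≈-trans (≡⇒≈ (cong +_ (sym (ℕ.+-suc (l ℕ.* p) (s ℕ.+ h)))))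
      (≈-trans (+-≈ (ap≈0 l) (≈-refl {+ suc (s ℕ.+ h)})) (≡⇒≈ (+-identityˡ (+ suc (s ℕ.+ h)))))))
      (unit-<prime p-prime (ℕ.s≤s s+h<q))

  F≈0-step k l zero    _ = begin
    + 2 * + suc (k ℕ.+ L) * (+ 2 * + L + 1ℤ) * F k L
      ≡⟨ cong (λ x → + 2 * + suc (k ℕ.+ L) * (+ 2 * (x + + h) + 1ℤ) * F k L) (pos-* l p) ⟩
    + 2 * + suc (k ℕ.+ L) * (+ 2 * (+ l * (1ℤ + (+ h + + h)) + + h) + 1ℤ) * F k L
      ≡⟨ e (+ suc (k ℕ.+ L)) (+ l) (+ h) (F k L) ⟩
    + 2 * + suc (k ℕ.+ L) * (+ 2 * + l + 1ℤ) * F k L * P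
      ≈⟨ multiple≈0 (+ 2 * + suc (k ℕ.+ L) * (+ 2 * + l + 1ℤ) * F k L) ⟩
    0ℤ ∎
    where
    open ≈-Reasoning P
    L = l ℕ.* p ℕ.+ h
    e : ∀ k l h f → + 2 * k * (+ 2 * (l * (1ℤ + (h + h)) + h) + 1ℤ) * f
      ≡ + 2 * k * (+ 2 * l + 1ℤ) * f * (1ℤ + (h + h))
    e = solve-∀
  F≈0-step k l (suc s) s<h′ = ≈-trans
    (*-≈ˡ (+ 2 * + suc (k ℕ.+ L) * (+ 2 * + L + 1ℤ)) (F≈0 k l s (ℕ.<⇒≤ s<h′)))
    (≡⇒≈ (*-zeroʳ (+ 2 * + suc (k ℕ.+ L) * (+ 2 * + L + 1ℤ))))
    where
    L = l ℕ.* p ℕ.+ (suc s ℕ.+ h)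

  -- Two digits with sum 2h are both h, or exactly one of them exceeds h; the hypotheses cover the
  -- latter on either side.
  conv-center : ∀ G →
    (∀ r s → r ℕ.+ s ≡ h′ → G r (suc s ℕ.+ h) ≈ 0ℤ [ P ]) →
    (∀ r s → r ℕ.+ s ≡ h′ → G (suc (h ℕ.+ r)) s ≈ 0ℤ [ P ]) →
    conv G q ≈ G h h [ P ]
  conv-center G G≈0ˡ G≈0ʳ = begin
    conv G (h ℕ.+ suc h′)
      ≡⟨ conv-split G h h′ ⟩
    conv (λ r s → G r (s ℕ.+ h)) (suc h′) + conv (λ r s → G (suc h ℕ.+ r) s) h′
      ≡⟨ cong (_+ conv (λ r s → G (suc h ℕ.+ r) s) h′) (conv-last (λ r s → G r (s ℕ.+ h)) h′) ⟩
    conv (λ r s → G r (suc s ℕ.+ h)) h′ + G h h + conv (λ r s → G (suc h ℕ.+ r) s) h′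
      ≈⟨ +-≈ (+-≈ (vanish (λ r s → G r (suc s ℕ.+ h)) G≈0ˡ) (≈-refl {G h h})) (vanish (λ r s → G (suc h ℕ.+ r) s) G≈0ʳ) ⟩
    0ℤ + G h h + 0ℤ
      ≡⟨ trans (+-identityʳ _) (+-identityˡ (G h h)) ⟩
    G h h ∎
    where
    open ≈-Reasoning P
    vanish : ∀ g → (∀ r s → r ℕ.+ s ≡ h′ → g r s ≈ 0ℤ [ P ]) → conv g h′ ≈ 0ℤ [ P ]
    vanish g g≈0 = ≈-trans (conv-≈ h′ g≈0) (≡⇒≈ (conv-0 h′))

  -- Doubling the digit h gives p - 1 without a carry. The parts prime to p contribute w³ above and
  -- (h! h!)³ below, and (h!)² is congruent to (-1)^h w.
  F-center : ∀ j l → F (j ℕ.* p ℕ.+ h) (l ℕ.* p ℕ.+ h) ≈ -1ℤ ^ h * F j l [ P ]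
  F-center j l = unit-cancelʳ (unit-units-cube p-prime j l h≤q h≤q) (begin
    F (j ℕ.* p ℕ.+ h) (l ℕ.* p ℕ.+ h) * X
      ≡⟨ F-units j l h h {j ℕ.+ l} {j ℕ.+ j} {l ℕ.+ l} {q} {q} {q} {1ℤ} {F j l}
           (e₁ j l h p) (e₁ j j h p) (e₁ l l h p)
           (trans (pow-diag P j l) (sym (*-identityˡ _))) (sym (F-fac j l)) ⟩
    1ℤ * F j l * (units (j ℕ.+ l) q * units (j ℕ.+ j) q * units (l ℕ.+ l) q)
      ≈⟨ *-≈ˡ (1ℤ * F j l) (units-product (j ℕ.+ l) (j ℕ.+ j) (l ℕ.+ l) q q q) ⟩
    1ℤ * F j l * (w ^ (j ℕ.+ l) * w ^ (j ℕ.+ j) * w ^ (l ℕ.+ l) * (w * w * w))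
      ≡⟨ cong (λ x → 1ℤ * F j l * (x * (w * w * w))) (pow-diag w j l) ⟩
    1ℤ * F j l * (W * (w * w * w))
      -- Insert ε⁴ = 1: three of the signs pair with w³ to form `cube (ε * w)`, and one remains.
      ≡⟨ cong (λ x → x * F j l * (W * (w * w * w))) (sym (cong₂ _*_ ([-1]^n*[-1]^n≡1 h) ([-1]^n*[-1]^n≡1 h))) ⟩
    ε * ε * (ε * ε) * F j l * (W * (w * w * w))
      ≡⟨ e₂ ε (F j l) W w ⟩
    ε * F j l * (W * cube (ε * w))
      ≈⟨ *-≈ˡ (ε * F j l) (*-≈ˡ W (cube-≈ (fac-reflect h h refl))) ⟨
    ε * F j l * (W * cube (fac h * fac h))
      ≈⟨ *-≈ˡ (ε * F j l) (units-cube j l h h) ⟨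
    ε * F j l * X ∎)
    where
    open ≈-Reasoning P
    h≤q : h ℕ.≤ q
    h≤q = ℕ.m≤m+n h h
    X W ε : ℤ
    X = cube (units j h * units l h)
    W = cube (w ^ j * w ^ l)
    ε = -1ℤ ^ h
    e₁ : ∀ j l h p → j ℕ.* p ℕ.+ h ℕ.+ (l ℕ.* p ℕ.+ h) ≡ (j ℕ.+ l) ℕ.* p ℕ.+ (h ℕ.+ h)
    e₁ = ℕ.solve-∀
    e₂ : ∀ ε f W w → ε * ε * (ε * ε) * f * (W * (w * w * w)) ≡ ε * f * (W * (ε * w * (ε * w) * (ε * w)))
    e₂ = solve-∀

  T-center : ∀ n → T (n ℕ.* p ℕ.+ q) ≈ -1ℤ ^ h * T n [ P ]
  T-center n = begin
    T (n ℕ.* p ℕ.+ q)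
      ≡⟨ conv-digits F q n ⟩
    conv (λ j l → conv (λ r s → F (j ℕ.* p ℕ.+ r) (l ℕ.* p ℕ.+ s)) q) n
      ≈⟨ conv-≈ n (λ j l _ → ≈-trans
           (conv-center (λ r s → F (j ℕ.* p ℕ.+ r) (l ℕ.* p ℕ.+ s))
             (λ r s r+s≡h′ → F≈0 (j ℕ.* p ℕ.+ r) l s (subst (s ℕ.≤_) r+s≡h′ (ℕ.m≤n+m s r)))
             (λ r s r+s≡h′ → ≈-trans (≡⇒≈ (trans (F-sym (j ℕ.* p ℕ.+ suc (h ℕ.+ r)) _)
                 (cong (λ x → F (l ℕ.* p ℕ.+ s) (j ℕ.* p ℕ.+ suc x)) (ℕ.+-comm h r))))
               (F≈0 (l ℕ.* p ℕ.+ s) j r (subst (r ℕ.≤_) r+s≡h′ (ℕ.m≤m+n r s)))))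
           (F-center j l)) ⟩
    conv (λ j l → -1ℤ ^ h * F j l) n
      ≡⟨ conv-* (-1ℤ ^ h) F n ⟩
    -1ℤ ^ h * T n ∎
    where open ≈-Reasoning P

  -- By Fermat, 1/(k + 1)² modulo p.
  invSquare : ℕ → ℤ
  invSquare k = (+ suc k) ^ m

  V : ℤ
  V = conv (λ k _ → -1ℤ ^ suc k * invSquare k) h′

  -- The digits are r = ρ + 1 ≤ h and s = σ + h + 1 with r + s = p. There are carries in the sum of
  -- the indices and in the doubling of the second, but none in the doubling of the first. Their p²
  -- leaves the other factor to be found modulo p only.
  F-middle : ∀ j l ρ σ → ρ ℕ.+ σ ≡ h′ →
    F (j ℕ.* p ℕ.+ suc ρ) (l ℕ.* p ℕ.+ suc (σ ℕ.+ suc h′))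
      ≈ P * P * (+ suc (j ℕ.+ l) * + suc (l ℕ.+ l) * F j l * (+ 2 * (-1ℤ ^ suc ρ * invSquare ρ))) [ P³ ]
  F-middle j l ρ σ ρ+σ≡h′ = unit-cancelʳ (unit-lift (unit-units-cube p-prime j l r≤q s≤q)) (begin
    F (j ℕ.* p ℕ.+ r) (l ℕ.* p ℕ.+ s) * X
      ≡⟨ F-units j l r s {suc (j ℕ.+ l)} {j ℕ.+ j} {suc (l ℕ.+ l)} {0} {r ℕ.+ r} {suc (σ ℕ.+ σ)} {P * P} {M}
           (e₁ j l ρ σ h′ ρ+σ≡h′) (e₂ j r p) (e₃ l σ h′) (pow-carry P j l) (fac-carry j l) ⟩
    P * P * M * Y
      ≡⟨ *-assoc (P * P) M Y ⟩
    P * P * (M * Y)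
      ≈⟨ ≈-scale (P * P) (*-≈ˡ M cX≈Y) ⟨
    P * P * (M * (c * X))
      ≡⟨ e₄ (P * P) M c X ⟩
    P * P * (M * c) * X ∎)
    where
    open ≈-Reasoning P³
    r = suc ρ
    s = suc (σ ℕ.+ suc h′)
    ε X Y W M c : ℤ
    ε = -1ℤ ^ r
    X = cube (units j r * units l s)
    Y = units (suc (j ℕ.+ l)) 0 * units (j ℕ.+ j) (r ℕ.+ r) * units (suc (l ℕ.+ l)) (suc (σ ℕ.+ σ))
    W = cube (w ^ j * w ^ l)
    M = + suc (j ℕ.+ l) * + suc (l ℕ.+ l) * F j l
    c = + 2 * (ε * invSquare ρ)
    ρ≤h′ : ρ ℕ.≤ h′
    ρ≤h′ = subst (ρ ℕ.≤_) ρ+σ≡h′ (ℕ.m≤m+n ρ σ)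
    r≤q : r ℕ.≤ q
    r≤q = ℕ.≤-trans (ℕ.s≤s ρ≤h′) (ℕ.m≤m+n h h)
    s≤q : s ℕ.≤ q
    s≤q = ℕ.s≤s (ℕ.+-monoˡ-≤ (suc h′) (subst (σ ℕ.≤_) ρ+σ≡h′ (ℕ.m≤n+m σ ρ)))
    e₁ : ∀ j l ρ σ h′ → ρ ℕ.+ σ ≡ h′ → let p = suc (suc h′ ℕ.+ suc h′) in
      j ℕ.* p ℕ.+ suc ρ ℕ.+ (l ℕ.* p ℕ.+ suc (σ ℕ.+ suc h′)) ≡ suc (j ℕ.+ l) ℕ.* p ℕ.+ 0
    e₁ j l ρ σ _ refl = e j l ρ σ
      where
      e : ∀ j l ρ σ → j ℕ.* suc (suc (ρ ℕ.+ σ) ℕ.+ suc (ρ ℕ.+ σ)) ℕ.+ suc ρ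
          ℕ.+ (l ℕ.* suc (suc (ρ ℕ.+ σ) ℕ.+ suc (ρ ℕ.+ σ)) ℕ.+ suc (σ ℕ.+ suc (ρ ℕ.+ σ)))
        ≡ suc (j ℕ.+ l) ℕ.* suc (suc (ρ ℕ.+ σ) ℕ.+ suc (ρ ℕ.+ σ)) ℕ.+ 0
      e = ℕ.solve-∀
    e₂ : ∀ j r p → j ℕ.* p ℕ.+ r ℕ.+ (j ℕ.* p ℕ.+ r) ≡ (j ℕ.+ j) ℕ.* p ℕ.+ (r ℕ.+ r)
    e₂ = ℕ.solve-∀
    e₃ : ∀ l σ h′ → l ℕ.* suc (suc h′ ℕ.+ suc h′) ℕ.+ suc (σ ℕ.+ suc h′)
        ℕ.+ (l ℕ.* suc (suc h′ ℕ.+ suc h′) ℕ.+ suc (σ ℕ.+ suc h′))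
      ≡ suc (l ℕ.+ l) ℕ.* suc (suc h′ ℕ.+ suc h′) ℕ.+ suc (σ ℕ.+ σ)
    e₃ = ℕ.solve-∀
    e₄ : ∀ p m c x → p * (m * (c * x)) ≡ p * (m * c) * x
    e₄ = solve-∀
    e₅ : ∀ ε V W w r → + 2 * (ε * V) * (W * (-1ℤ * (ε * w * r) * (-1ℤ * (ε * w * r)) * (-1ℤ * (ε * w * r))))
      ≡ ε * ε * (ε * ε) * (-1ℤ * (w * w * W * w * (r + r))) * (r * r * V)
    e₅ = solve-∀
    e₆ : ∀ W w r → 1ℤ * 1ℤ * (-1ℤ * (w * w * W * w * (r + r))) * 1ℤ ≡ w * w * W * (-1ℤ * (1ℤ * w * (r + r)))
    e₆ = solve-∀
    q-even : ∀ ρ σ h′ → ρ ℕ.+ σ ≡ h′ → suc ρ ℕ.+ suc ρ ℕ.+ (σ ℕ.+ σ) ≡ suc h′ ℕ.+ suc h′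
    q-even ρ σ _ refl = e ρ σ
      where
      e : ∀ ρ σ → suc ρ ℕ.+ suc ρ ℕ.+ (σ ℕ.+ σ) ≡ suc (ρ ℕ.+ σ) ℕ.+ suc (ρ ℕ.+ σ)
      e = ℕ.solve-∀
    -- By reflection (2r)! (2σ+1)! is congruent to -2 r w and r! s! to -(-1)^r r w. With the w² from
    -- the two carries the quotient is 2 (-1)^r / r², which is `c`.
    cX≈Y : c * X ≈ Y [ P ]
    cX≈Y = R.begin
      c * X
        R.≈⟨ *-≈ˡ c (units-cube j l r s) ⟩
      c * (W * cube (fac r * fac s))
        R.≈⟨ *-≈ˡ c (*-≈ˡ W (cube-≈ (fac-reflect′ r (σ ℕ.+ suc h′)
              (cong suc (trans (sym (ℕ.+-assoc ρ σ (suc h′))) (cong (ℕ._+ suc h′) ρ+σ≡h′)))))) ⟩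
      c * (W * cube (-1ℤ * (ε * w * + r)))
        R.≡⟨ e₅ ε (invSquare ρ) W w (+ r) ⟩
      ε * ε * (ε * ε) * (-1ℤ * (w * w * W * w * (+ r + + r))) * (+ r * + r * invSquare ρ)
        R.≈⟨ *-≈ (≡⇒≈ (cong (λ x → x * x * (-1ℤ * (w * w * W * w * (+ r + + r)))) ([-1]^n*[-1]^n≡1 r)))
               (inverse-square (ℕ.s≤s r≤q)) ⟩
      1ℤ * 1ℤ * (-1ℤ * (w * w * W * w * (+ r + + r))) * 1ℤ
        R.≡⟨ e₆ W w (+ r) ⟩
      w * w * W * (-1ℤ * (1ℤ * w * (+ r + + r)))
        R.≡⟨ cong (λ x → w * w * W * (-1ℤ * (x * w * (+ r + + r)))) ([-1]^[n+n]≡1 r) ⟨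
      w * w * W * (-1ℤ * (-1ℤ ^ (r ℕ.+ r) * w * (+ r + + r)))
        R.≈⟨ *-≈ˡ (w * w * W) (fac-reflect′ (r ℕ.+ r) (σ ℕ.+ σ) (q-even ρ σ h′ ρ+σ≡h′)) ⟨
      w * w * W * (fac (r ℕ.+ r) * fac (suc (σ ℕ.+ σ)))
        R.≡⟨ cong (λ x → w * w * W * (x * fac (suc (σ ℕ.+ σ)))) (*-identityˡ (fac (r ℕ.+ r))) ⟨
      w * w * W * (1ℤ * fac (r ℕ.+ r) * fac (suc (σ ℕ.+ σ)))
        R.≡⟨ cong (_* (1ℤ * fac (r ℕ.+ r) * fac (suc (σ ℕ.+ σ)))) (pow-carry w j l) ⟨
      w ^ suc (j ℕ.+ l) * w ^ (j ℕ.+ j) * w ^ suc (l ℕ.+ l) * (fac 0 * fac (r ℕ.+ r) * fac (suc (σ ℕ.+ σ)))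
        R.≈⟨ units-product (suc (j ℕ.+ l)) (j ℕ.+ j) (suc (l ℕ.+ l)) 0 (r ℕ.+ r) (suc (σ ℕ.+ σ)) ⟨
      Y R.∎
      where module R = ≈-Reasoning P

  -- For r ≤ h the carry falls on `l` and gives the weight 2l + 1; the mirrored half gives 2j + 1.
  -- The two weights add up to 2(n + 1), which explains the square and the 4.
  block-middle : ∀ n j l → j ℕ.+ l ≡ n →
    conv (λ r s → F (j ℕ.* p ℕ.+ suc r) (l ℕ.* p ℕ.+ suc s)) (h′ ℕ.+ suc h′)
      ≈ P * P * (+ 4 * (+ suc n * + suc n) * V) * F j l [ P³ ]
  block-middle n j l j+l≡n = begin
    conv G (h′ ℕ.+ suc h′)
      ≡⟨ conv-split G h′ h′ ⟩
    conv (λ r s → G r (s ℕ.+ suc h′)) h′ + conv (λ r s → G (suc h′ ℕ.+ r) s) h′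
      ≡⟨ cong₂ _+_ (refl {x = conv (λ r s → G r (s ℕ.+ suc h′)) h′}) (conv-swap (λ r s → G (suc h′ ℕ.+ r) s) h′) ⟩
    conv (λ r s → G r (s ℕ.+ suc h′)) h′ + conv (λ r s → G (suc h′ ℕ.+ s) r) h′
      ≈⟨ +-≈ (half j l (λ r s → G r (s ℕ.+ suc h′)) (λ r s → refl))
             (half l j (λ r s → G (suc h′ ℕ.+ s) r) (λ r s → trans
               (cong (λ x → F (j ℕ.* p ℕ.+ suc x) (l ℕ.* p ℕ.+ suc r)) (ℕ.+-comm (suc h′) s))
               (F-sym (j ℕ.* p ℕ.+ suc (s ℕ.+ suc h′)) (l ℕ.* p ℕ.+ suc r)))) ⟩
    P * P * (+ suc (j ℕ.+ l) * + suc (l ℕ.+ l) * F j l * (+ 2 * V))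
      + P * P * (+ suc (l ℕ.+ j) * + suc (j ℕ.+ j) * F l j * (+ 2 * V))
      ≡⟨ cong₂ (λ x y → P * P * (+ suc (j ℕ.+ l) * + suc (l ℕ.+ l) * F j l * (+ 2 * V))
           + P * P * (+ suc x * + suc (j ℕ.+ j) * y * (+ 2 * V))) (ℕ.+-comm l j) (F-sym l j) ⟩
    P * P * (+ suc (j ℕ.+ l) * + suc (l ℕ.+ l) * F j l * (+ 2 * V))
      + P * P * (+ suc (j ℕ.+ l) * + suc (j ℕ.+ j) * F j l * (+ 2 * V))
      ≡⟨ e (P * P) (+ j) (+ l) (F j l) V ⟩
    P * P * (+ 4 * (+ suc (j ℕ.+ l) * + suc (j ℕ.+ l)) * V) * F j l
      ≡⟨ cong (λ x → P * P * (+ 4 * (+ suc x * + suc x) * V) * F j l) j+l≡n ⟩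
    P * P * (+ 4 * (+ suc n * + suc n) * V) * F j l ∎
    where
    open ≈-Reasoning P³
    G : ℕ → ℕ → ℤ
    G r s = F (j ℕ.* p ℕ.+ suc r) (l ℕ.* p ℕ.+ suc s)
    e : ∀ p j l f v → p * ((1ℤ + (j + l)) * (1ℤ + (l + l)) * f * (+ 2 * v)) + p * ((1ℤ + (j + l)) * (1ℤ + (j + j)) * f * (+ 2 * v))
      ≡ p * (+ 4 * ((1ℤ + (j + l)) * (1ℤ + (j + l))) * v) * f
    e = solve-∀
    e′ : ∀ p m v → p * (m * (+ 2 * v)) ≡ p * (m * + 2) * v
    e′ = solve-∀
    half : ∀ j l g → (∀ r s → g r s ≡ F (j ℕ.* p ℕ.+ suc r) (l ℕ.* p ℕ.+ suc (s ℕ.+ suc h′))) →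
      conv g h′ ≈ P * P * (+ suc (j ℕ.+ l) * + suc (l ℕ.+ l) * F j l * (+ 2 * V)) [ P³ ]
    half j l g g≡F = begin
      conv g h′
        ≈⟨ conv-≈ h′ (λ r s r+s≡h′ → ≈-trans (≡⇒≈ (g≡F r s)) (≈-trans (F-middle j l r s r+s≡h′)
             (≡⇒≈ (e′ (P * P) M (-1ℤ ^ suc r * invSquare r))))) ⟩
      conv (λ r s → P * P * (M * + 2) * (-1ℤ ^ suc r * invSquare r)) h′
        ≡⟨ conv-* (P * P * (M * + 2)) (λ r s → -1ℤ ^ suc r * invSquare r) h′ ⟩
      P * P * (M * + 2) * V
        ≡⟨ e′ (P * P) M V ⟨
      P * P * (M * (+ 2 * V)) ∎
      where
      M : ℤ
      M = + suc (j ℕ.+ l) * + suc (l ℕ.+ l) * F j l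

  T-multiple : ∀ n → T (suc n ℕ.* p)
    ≈ conv (λ j l → F (j ℕ.* p) (l ℕ.* p)) (suc n) + P * P * (+ 4 * (+ suc n * + suc n) * V) * T n [ P³ ]
  T-multiple n = begin
    T (suc n ℕ.* p)
      ≡⟨ conv-multiples F (h′ ℕ.+ suc h′) n ⟩
    D + conv (λ j l → conv (λ r s → F (j ℕ.* p ℕ.+ suc r) (l ℕ.* p ℕ.+ suc s)) (h′ ℕ.+ suc h′)) n
      ≈⟨ +-≈ (≈-refl {D}) (conv-≈ n (block-middle n)) ⟩
    D + conv (λ j l → P * P * (+ 4 * (+ suc n * + suc n) * V) * F j l) n
      ≡⟨ cong₂ _+_ (refl {x = D}) (conv-* (P * P * (+ 4 * (+ suc n * + suc n) * V)) F n) ⟩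
    D + P * P * (+ 4 * (+ suc n * + suc n) * V) * T n ∎
    where
    open ≈-Reasoning P³
    D : ℤ
    D = conv (λ j l → F (j ℕ.* p) (l ℕ.* p)) (suc n)

  -- With a = N p, the coefficient 3a² + 3a + 1 is (1 + a)³ - a³, and a³ vanishes modulo p³.
  -- Dividing the recurrence by the unit (1 + a)² therefore leaves just 1 + a.
  T-multiple+1 : ∀ n → T (suc (suc n ℕ.* p))
    ≈ + 4 * (1ℤ + + suc n * P) * T (suc n ℕ.* p) - + 32 * (+ suc n * + suc n) * (-1ℤ ^ h * T n) * (P * P) [ P³ ]
  T-multiple+1 n = unit-cancelʳ (unit-lift (unit-* unit-1+a unit-1+a)) (begin
    X * ((1ℤ + a) * (1ℤ + a))
      ≡⟨ *-comm X _ ⟩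
    (1ℤ + a) * (1ℤ + a) * X
      ≡⟨ cong (λ x → (1ℤ + x) * (1ℤ + x) * X) (pos-* (suc n) p) ⟨
    + suc (suc n ℕ.* p) * + suc (suc n ℕ.* p) * X
      ≡⟨ cong (λ x → + suc x * + suc x * T (suc x)) np+q+1 ⟨
    + suc (suc (n ℕ.* p ℕ.+ q)) * + suc (suc (n ℕ.* p ℕ.+ q)) * T (suc (suc (n ℕ.* p ℕ.+ q)))
      ≡⟨ T-rec (n ℕ.* p ℕ.+ q) ⟩
    + 4 * (+ 3 * (+ suc (n ℕ.* p ℕ.+ q) * + suc (n ℕ.* p ℕ.+ q)) + + 3 * + suc (n ℕ.* p ℕ.+ q) + 1ℤ) * T (suc (n ℕ.* p ℕ.+ q))
      - + 32 * (+ suc (n ℕ.* p ℕ.+ q) * + suc (n ℕ.* p ℕ.+ q)) * Z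
      ≡⟨ cong₂ (λ x y → + 4 * (+ 3 * (y * y) + + 3 * y + 1ℤ) * T x - + 32 * (y * y) * Z) np+q+1
           (trans (cong +_ np+q+1) (pos-* (suc n) p)) ⟩
    + 4 * (+ 3 * (a * a) + + 3 * a + 1ℤ) * Y - + 32 * (a * a) * Z
      ≡⟨ e₁ N P Y Z ⟩
    + 4 * (+ 3 * (a * a) + + 3 * a + 1ℤ) * Y + P * P * (- + 32 * (N * N) * Z)
      ≈⟨ +-≈ Y≈ (≈-scale (P * P) (*-≈ˡ (- + 32 * (N * N)) Z≈)) ⟩
    + 4 * (1ℤ + a) * Y * ((1ℤ + a) * (1ℤ + a)) + P * P * (- + 32 * (N * N) * ((1ℤ + a) * (1ℤ + a) * (-1ℤ ^ h * T n)))
      ≡⟨ e₃ N P Y (-1ℤ ^ h * T n) ⟩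
    (+ 4 * (1ℤ + a) * Y - + 32 * (N * N) * (-1ℤ ^ h * T n) * (P * P)) * ((1ℤ + a) * (1ℤ + a)) ∎)
    where
    open ≈-Reasoning P³
    N a X Y Z : ℤ
    N = + suc n
    a = N * P
    X = T (suc (suc n ℕ.* p))
    Y = T (suc n ℕ.* p)
    Z = T (n ℕ.* p ℕ.+ q)
    np+q+1 : suc (n ℕ.* p ℕ.+ q) ≡ suc n ℕ.* p
    np+q+1 = cong suc (ℕ.+-comm (n ℕ.* p) q)
    1+a≈1 : 1ℤ + a ≈ 1ℤ [ P ]
    1+a≈1 = quot N refl
    unit-1+a : Unit P (1ℤ + a)
    unit-1+a = unit-≈ (≈-sym 1+a≈1) unit-1
    -- The factor (1 + a)², congruent to 1 modulo p, is inserted so that it can be cancelled from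
    -- the whole equation.
    Z≈ : Z ≈ (1ℤ + a) * (1ℤ + a) * (-1ℤ ^ h * T n) [ P ]
    Z≈ = ≈-trans (T-center n) (≈-trans (≡⇒≈ (sym (*-identityˡ (-1ℤ ^ h * T n))))
      (*-≈ʳ (-1ℤ ^ h * T n) (≈-sym (*-≈ 1+a≈1 1+a≈1))))
    e₁ : ∀ n p y z → + 4 * (+ 3 * (n * p * (n * p)) + + 3 * (n * p) + 1ℤ) * y - + 32 * (n * p * (n * p)) * z
      ≡ + 4 * (+ 3 * (n * p * (n * p)) + + 3 * (n * p) + 1ℤ) * y + p * p * (- + 32 * (n * n) * z)
    e₁ = solve-∀
    e₂ : ∀ n p y → + 4 * (+ 3 * (n * p * (n * p)) + + 3 * (n * p) + 1ℤ) * y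
      ≡ + 4 * (1ℤ + n * p) * y * ((1ℤ + n * p) * (1ℤ + n * p)) + - (+ 4 * (n * n * n) * y) * (p * p * p)
    e₂ = solve-∀
    Y≈ : + 4 * (+ 3 * (a * a) + + 3 * a + 1ℤ) * Y ≈ + 4 * (1ℤ + a) * Y * ((1ℤ + a) * (1ℤ + a)) [ P³ ]
    Y≈ = quot (- (+ 4 * (N * N * N) * Y)) (e₂ N P Y)
    e₃ : ∀ n p y t → + 4 * (1ℤ + n * p) * y * ((1ℤ + n * p) * (1ℤ + n * p))
        + p * p * (- + 32 * (n * n) * ((1ℤ + n * p) * (1ℤ + n * p) * t))
      ≡ (+ 4 * (1ℤ + n * p) * y - + 32 * (n * n) * t * (p * p)) * ((1ℤ + n * p) * (1ℤ + n * p))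
    e₃ = solve-∀

-- The case p > 3

fall : ℤ → ℕ → ℤ
fall x zero    = 1ℤ
fall x (suc n) = fall x n * (x - + suc n)

rise-front : ∀ x n → rise x (suc n) ≡ (x + 1ℤ) * rise (x + 1ℤ) n
rise-front x zero    = *-comm 1ℤ (x + 1ℤ)
rise-front x (suc n) = trans (cong (_* (x + + suc (suc n))) (rise-front x n)) (e x (+ suc n) (rise (x + 1ℤ) n))
  where
  e : ∀ x n y → (x + 1ℤ) * y * (x + (1ℤ + n)) ≡ (x + 1ℤ) * (y * (x + 1ℤ + n))
  e = solve-∀

rise≡fall : ∀ x n → rise x n ≡ fall (x + + suc n) n
rise≡fall x zero    = refl
rise≡fall x (suc n) = begin
  rise x (suc n)                                     ≡⟨ rise-front x n ⟩
  (x + 1ℤ) * rise (x + 1ℤ) n                         ≡⟨ *-comm (x + 1ℤ) _ ⟩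
  rise (x + 1ℤ) n * (x + 1ℤ)                         ≡⟨ cong₂ _*_ (rise≡fall (x + 1ℤ) n) (e₁ x (+ suc n)) ⟩
  fall (x + 1ℤ + + suc n) n * (x + (1ℤ + + suc n) - + suc n)
    ≡⟨ cong (λ z → fall z n * (x + (1ℤ + + suc n) - + suc n)) (e₂ x (+ suc n)) ⟩
  fall (x + + suc (suc n)) (suc n)                   ∎
  where
  open ≡-Reasoning
  e₁ : ∀ x n → x + 1ℤ ≡ x + (1ℤ + n) - n
  e₁ = solve-∀
  e₂ : ∀ x n → x + 1ℤ + n ≡ x + (1ℤ + n)
  e₂ = solve-∀

rise-+ : ∀ x a b → rise x (a ℕ.+ b) ≡ rise x a * rise (x + + a) b
rise-+ x a zero    = trans (cong (rise x) (ℕ.+-identityʳ a)) (sym (*-identityʳ (rise x a)))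
rise-+ x a (suc b) = trans (cong (rise x) (ℕ.+-suc a b))
  (trans (cong₂ (λ y z → y * (x + + z)) (rise-+ x a b) (sym (ℕ.+-suc a b)))
    (e x (+ a) (+ suc b) (rise x a) (rise (x + + a) b)))
  where
  e : ∀ x a b y z → y * z * (x + (a + b)) ≡ y * (z * (x + a + b))
  e = solve-∀

-- The upper half is read backwards, so that for p = 2h + 1 the factor x + r stands opposite x + p -
-- r.
rise-pairs : ∀ x h → rise x (h ℕ.+ h) ≡ rise x h * fall (x + + suc (h ℕ.+ h)) h
rise-pairs x h = trans (rise-+ x h h) (cong (rise x h *_)
  (trans (rise≡fall (x + + h) h) (cong (λ z → fall z h) (trans (+-assoc x (+ h) (+ suc h)) (cong (λ z → x + + z) (ℕ.+-suc h h))))))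

-- Unlike `conv`, it grows at the upper end, as `rise` and `fall` do in the induction of
-- `rise-pairs-≈`.
sum< : (ℕ → ℤ) → ℕ → ℤ
sum< f zero    = 0ℤ
sum< f (suc n) = sum< f n + f n

conv≡sum< : ∀ f n → conv (λ k _ → f k) n ≡ sum< f (suc n)
conv≡sum< f zero    = sym (+-identityˡ (f 0))
conv≡sum< f (suc n) = trans (conv-last (λ k _ → f k) n) (cong (_+ f (suc n)) (conv≡sum< f n))

conv-parity : ∀ (f : ℕ → ℤ) n → conv (λ k _ → f k) (n ℕ.+ suc n)
  ≡ conv (λ k _ → f (k ℕ.+ k)) n + conv (λ k _ → f (suc (k ℕ.+ k))) n
conv-parity f zero    = refl
conv-parity f (suc n) = begin
  f 0 + conv (λ k _ → f (suc k)) (n ℕ.+ suc (suc n))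
    ≡⟨ cong (λ x → f 0 + conv (λ k _ → f (suc k)) x) (ℕ.+-suc n (suc n)) ⟩
  f 0 + (f 1 + conv (λ k _ → f (suc (suc k))) (n ℕ.+ suc n))
    ≡⟨ cong (λ x → f 0 + (f 1 + x)) (trans (conv-parity (λ k → f (suc (suc k))) n) (cong₂ _+_
         (conv-cong n λ k _ _ → cong (λ x → f (suc x)) (sym (ℕ.+-suc k k)))
         (conv-cong n λ k _ _ → cong (λ x → f (suc (suc x))) (sym (ℕ.+-suc k k))))) ⟩
  f 0 + (f 1 + (conv (λ k _ → f (suc k ℕ.+ suc k)) n + conv (λ k _ → f (suc (suc k ℕ.+ suc k))) n))
    ≡⟨ e (f 0) (f 1) _ _ ⟩
  f 0 + conv (λ k _ → f (suc k ℕ.+ suc k)) n + (f 1 + conv (λ k _ → f (suc (suc k ℕ.+ suc k))) n) ∎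
  where
  open ≡-Reasoning
  e : ∀ a b c d → a + (b + (c + d)) ≡ a + c + (b + d)
  e = solve-∀

module Wolstenholme (h″ : ℕ) (p-prime : Prime (suc (suc (suc h″) ℕ.+ suc (suc h″)))) where

  h′ : ℕ
  h′ = suc h″

  open Odd h′ p-prime
  open Blocks q

  ^-negate : ∀ {x y} → x + y ≈ 0ℤ [ P ] → x ^ m ≈ y ^ m [ P ]
  ^-negate {x} {y} x+y≈0 = begin
    x ^ m                  ≈⟨ ^-≈ m x≈-y ⟩
    (-1ℤ * y) ^ m          ≡⟨ ^-distribʳ-* -1ℤ y m ⟩
    -1ℤ ^ m * y ^ m        ≡⟨ cong (_* y ^ m) ([-1]^[n+n]≡1 h′) ⟩
    1ℤ * y ^ m             ≡⟨ *-identityˡ (y ^ m) ⟩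
    y ^ m                  ∎
    where
    open ≈-Reasoning P
    e₁ : ∀ x y → x ≡ x + y + -1ℤ * y
    e₁ = solve-∀
    x≈-y : x ≈ -1ℤ * y [ P ]
    x≈-y = ≈-trans (≡⇒≈ (e₁ x y)) (≈-trans (+-≈ x+y≈0 (≈-refl { -1ℤ * y})) (≡⇒≈ (+-identityˡ (-1ℤ * y))))

  invSquare-reflect : ∀ a b → suc a ℕ.+ suc b ≡ p → invSquare a ≈ invSquare b [ P ]
  invSquare-reflect a b a+b≡p = ^-negate {+ suc a} {+ suc b} (≈-trans (≡⇒≈ (cong +_ a+b≡p)) P≈0)

  H : ℤ
  H = conv (λ k _ → invSquare k) h′

  invSquare-double : ∀ k → invSquare (suc (k ℕ.+ k)) ≡ (+ 2) ^ m * invSquare k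
  invSquare-double k = trans (cong (_^ m) (e (+ k))) (^-distribʳ-* (+ 2) (+ suc k) m)
    where
    e : ∀ k → 1ℤ + (1ℤ + (k + k)) ≡ + 2 * (1ℤ + k)
    e = solve-∀

  -- Splitting Σ_{0<r<p} 1/r² once by r < p/2 and once by the parity of r gives 2 H = 2 H / 4.
  H-double : + 2 * H ≈ + 2 * ((+ 2) ^ m * H) [ P ]
  H-double = begin
    + 2 * H
      ≡⟨ e H ⟩
    H + H
      ≈⟨ +-≈ (≈-refl {H}) (conv-≈ h′ λ k l k+l≡h′ → invSquare-reflect k (suc h′ ℕ.+ l) (e₁ k l h′ k+l≡h′)) ⟩
    H + conv (λ k l → invSquare (suc h′ ℕ.+ l)) h′
      ≡⟨ cong₂ _+_ (refl {x = H}) (conv-swap (λ k _ → invSquare (suc h′ ℕ.+ k)) h′) ⟨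
    H + conv (λ k _ → invSquare (suc h′ ℕ.+ k)) h′
      ≡⟨ conv-split (λ k _ → invSquare k) h′ h′ ⟨
    conv (λ k _ → invSquare k) (h′ ℕ.+ suc h′)
      ≡⟨ conv-parity invSquare h′ ⟩
    conv (λ k _ → invSquare (k ℕ.+ k)) h′ + D
      ≡⟨ cong (_+ D) (conv-swap (λ k _ → invSquare (k ℕ.+ k)) h′) ⟩
    conv (λ k l → invSquare (l ℕ.+ l)) h′ + D
      -- Reflection r ↦ p - r carries the odd r = 2l + 1 to the even 2(k + 1), so both parity
      -- classes have the same sum `D`.
      ≈⟨ +-≈ (conv-≈ h′ λ k l k+l≡h′ → invSquare-reflect (l ℕ.+ l) (suc (k ℕ.+ k)) (e₂ k l h′ k+l≡h′)) (≈-refl {D}) ⟩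
    D + D
      ≡⟨ e D ⟨
    + 2 * D
      ≡⟨ cong (+ 2 *_) (trans (conv-cong h′ (λ k _ _ → invSquare-double k)) (conv-* ((+ 2) ^ m) (λ k _ → invSquare k) h′)) ⟩
    + 2 * ((+ 2) ^ m * H) ∎
    where
    open ≈-Reasoning P
    D : ℤ
    D = conv (λ k _ → invSquare (suc (k ℕ.+ k))) h′
    e : ∀ x → + 2 * x ≡ x + x
    e = solve-∀
    e₁ : ∀ k l h′ → k ℕ.+ l ≡ h′ → suc k ℕ.+ suc (suc h′ ℕ.+ l) ≡ suc (suc h′ ℕ.+ suc h′)
    e₁ k l _ refl = e₃ k l
      where
      e₃ : ∀ k l → suc k ℕ.+ suc (suc (k ℕ.+ l) ℕ.+ l) ≡ suc (suc (k ℕ.+ l) ℕ.+ suc (k ℕ.+ l))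
      e₃ = ℕ.solve-∀
    e₂ : ∀ k l h′ → k ℕ.+ l ≡ h′ → suc (l ℕ.+ l) ℕ.+ suc (suc (k ℕ.+ k)) ≡ suc (suc h′ ℕ.+ suc h′)
    e₂ k l _ refl = e₃ k l
      where
      e₃ : ∀ k l → suc (l ℕ.+ l) ℕ.+ suc (suc (k ℕ.+ k)) ≡ suc (suc (k ℕ.+ l) ℕ.+ suc (k ℕ.+ l))
      e₃ = ℕ.solve-∀

  2<p : 2 ℕ.< p
  2<p = ℕ.s≤s (ℕ.s≤s (ℕ.s≤s ℕ.z≤n))

  3<p : 3 ℕ.< p
  3<p = ℕ.s≤s (ℕ.s≤s (ℕ.s≤s (ℕ.≤-trans (ℕ.s≤s ℕ.z≤n) (ℕ.m≤n+m (suc (suc h″)) h″))))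

  -- Multiplying H-double by 4, with 4 * 2^m congruent to 1, gives 8 H ≡ 2 H, hence 6 H ≡ 0.
  -- Inverting 6 is where p > 3 enters.
  H≈0 : H ≈ 0ℤ [ P ]
  H≈0 = unit-cancelʳ (unit-* (unit-<prime p-prime 2<p) (unit-<prime p-prime 3<p)) (begin
    H * (+ 2 * + 3)
      ≡⟨ e₁ H ⟩
    + 4 * (+ 2 * H) + -1ℤ * (+ 2 * H)
      ≈⟨ +-≈ (*-≈ˡ (+ 4) H-double) (≈-refl { -1ℤ * (+ 2 * H)}) ⟩
    + 4 * (+ 2 * ((+ 2) ^ m * H)) + -1ℤ * (+ 2 * H)
      ≡⟨ e₂ H ((+ 2) ^ m) ⟩
    + 2 * + 2 * (+ 2) ^ m * (+ 2 * H) + -1ℤ * (+ 2 * H)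
      ≈⟨ +-≈ (*-≈ʳ (+ 2 * H) (inverse-square 2<p)) (≈-refl { -1ℤ * (+ 2 * H)}) ⟩
    1ℤ * (+ 2 * H) + -1ℤ * (+ 2 * H)
      ≡⟨ e₃ H ⟩
    0ℤ
      ≡⟨⟩
    0ℤ * (+ 2 * + 3) ∎)
    where
    open ≈-Reasoning P
    e₁ : ∀ x → x * (+ 2 * + 3) ≡ + 4 * (+ 2 * x) + -1ℤ * (+ 2 * x)
    e₁ = solve-∀
    e₂ : ∀ x t → + 4 * (+ 2 * (t * x)) + -1ℤ * (+ 2 * x) ≡ + 2 * + 2 * t * (+ 2 * x) + -1ℤ * (+ 2 * x)
    e₂ = solve-∀
    e₃ : ∀ x → 1ℤ * (+ 2 * x) + -1ℤ * (+ 2 * x) ≡ 0ℤ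
    e₃ = solve-∀

  -- (x + r) (x + p - r) = y + r (p - r) with y = x (x + p) = p² N (N + 1), so modulo p³
  -- the product is linear in y, with relative slope Σ 1/(r (p - r)) = -Σ 1/r².
  rise-pairs-≈ : ∀ N n → n ℕ.≤ h →
    rise (N * P) n * fall (N * P + P) n
      ≈ rise 0ℤ n * fall (0ℤ + P) n * (1ℤ - P * P * (N * (N + 1ℤ)) * sum< invSquare n) [ P³ ]
  rise-pairs-≈ N zero    _   = ≡⇒≈ (e (P * P * (N * (N + 1ℤ))))
    where
    e : ∀ y → 1ℤ * 1ℤ ≡ 1ℤ * 1ℤ * (1ℤ - y * 0ℤ)
    e = solve-∀
  rise-pairs-≈ N (suc n) n<h = begin
    rise (N * P) n * (N * P + r) * (fall (N * P + P) n * (N * P + P - r))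
      ≡⟨ e₁ (rise (N * P) n) (fall (N * P + P) n) N P r ⟩
    rise (N * P) n * fall (N * P + P) n * (P * P * (N * (N + 1ℤ)) + r * (P - r))
      ≈⟨ *-≈ʳ (P * P * (N * (N + 1ℤ)) + r * (P - r)) (rise-pairs-≈ N n (ℕ.<⇒≤ n<h)) ⟩
    A * (1ℤ - P * P * (N * (N + 1ℤ)) * s) * (P * P * (N * (N + 1ℤ)) + r * (P - r))
      -- The discarded term is quadratic in y = p² N (N + 1), hence a multiple of p⁴.
      ≈⟨ quot (- (P * A * s * (N * (N + 1ℤ) * (N * (N + 1ℤ))))) (e₂ A P (N * (N + 1ℤ)) s r i) ⟩
    A * (r * (P - r)) * (1ℤ - P * P * (N * (N + 1ℤ)) * (s + i)) + P * P * (A * (N * (N + 1ℤ)) * (1ℤ + r * (P - r) * i))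
      ≈⟨ +-≈ (≈-refl {A * (r * (P - r)) * (1ℤ - P * P * (N * (N + 1ℤ)) * (s + i))})
             (≈-scale (P * P) (*-≈ˡ (A * (N * (N + 1ℤ))) slope)) ⟩
    A * (r * (P - r)) * (1ℤ - P * P * (N * (N + 1ℤ)) * (s + i)) + P * P * (A * (N * (N + 1ℤ)) * 0ℤ)
      ≡⟨ e₃ (rise 0ℤ n) (fall (0ℤ + P) n) P r (N * (N + 1ℤ)) (s + i) ⟩
    rise 0ℤ n * (0ℤ + r) * (fall (0ℤ + P) n * (0ℤ + P - r)) * (1ℤ - P * P * (N * (N + 1ℤ)) * (s + i)) ∎
    where
    open ≈-Reasoning P³
    r i s A : ℤ
    r = + suc n
    i = invSquare n
    s = sum< invSquare n
    A = rise 0ℤ n * fall (0ℤ + P) n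
    e₁ : ∀ x y N P r → x * (N * P + r) * (y * (N * P + P - r)) ≡ x * y * (P * P * (N * (N + 1ℤ)) + r * (P - r))
    e₁ = solve-∀
    e₂ : ∀ A P z s r i → A * (1ℤ - P * P * z * s) * (P * P * z + r * (P - r))
      ≡ A * (r * (P - r)) * (1ℤ - P * P * z * (s + i)) + P * P * (A * z * (1ℤ + r * (P - r) * i))
        + - (P * A * s * (z * z)) * (P * P * P)
    e₂ = solve-∀
    e₃ : ∀ x y P r z s → x * y * (r * (P - r)) * (1ℤ - P * P * z * s) + P * P * (x * y * z * 0ℤ)
      ≡ x * (0ℤ + r) * (y * (0ℤ + P - r)) * (1ℤ - P * P * z * s)
    e₃ = solve-∀
    e₄ : ∀ P r i → 1ℤ + r * (P - r) * i ≡ 1ℤ + -1ℤ * (r * r * i) + r * i * P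
    e₄ = solve-∀
    slope : 1ℤ + r * (P - r) * i ≈ 0ℤ [ P ]
    slope = ≈-trans (≡⇒≈ (e₄ P r i)) (+-≈ {b = 0ℤ} (+-≈ (≈-refl {1ℤ}) (*-≈ˡ -1ℤ
      (inverse-square (ℕ.s≤s (ℕ.≤-trans n<h (ℕ.m≤m+n h h)))))) (multiple≈0 (r * i)))

  -- Wolstenholme's theorem in product form: the only deviation from (p - 1)! is p² times a multiple
  -- of `H`, and p divides `H`.
  rise-multiple : ∀ a → rise (+ (a ℕ.* p)) q ≈ w [ P³ ]
  rise-multiple a = begin
    rise (+ (a ℕ.* p)) q
      ≡⟨ cong (λ x → rise x q) (pos-* a p) ⟩
    rise (N * P) q
      ≡⟨ rise-pairs (N * P) h ⟩
    rise (N * P) h * fall (N * P + P) h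
      ≈⟨ rise-pairs-≈ N h ℕ.≤-refl ⟩
    A * (1ℤ - P * P * (N * (N + 1ℤ)) * sum< invSquare h)
      ≡⟨ cong (λ x → A * (1ℤ - P * P * (N * (N + 1ℤ)) * x)) (conv≡sum< invSquare h′) ⟨
    A * (1ℤ - P * P * (N * (N + 1ℤ)) * H)
      ≡⟨ e₁ A (P * P) (N * (N + 1ℤ)) H ⟩
    A + P * P * (- (A * (N * (N + 1ℤ))) * H)
      ≈⟨ +-≈ (≈-refl {A}) (≈-scale (P * P) (*-≈ˡ (- (A * (N * (N + 1ℤ)))) H≈0)) ⟩
    A + P * P * (- (A * (N * (N + 1ℤ))) * 0ℤ)
      ≡⟨ e₂ A (P * P) (N * (N + 1ℤ)) ⟩
    A
      ≡⟨ rise-pairs 0ℤ h ⟨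
    rise 0ℤ q
      ≡⟨ rise-0 q ⟩
    w ∎
    where
    open ≈-Reasoning P³
    N A : ℤ
    N = + a
    A = rise 0ℤ h * fall (0ℤ + P) h
    e₁ : ∀ A p z x → A * (1ℤ - p * z * x) ≡ A + p * (- (A * z) * x)
    e₁ = solve-∀
    e₂ : ∀ A p z → A + p * (- (A * z) * 0ℤ) ≡ A
    e₂ = solve-∀

  units-power : ∀ a → units a 0 ≈ w ^ a [ P³ ]
  units-power zero    = ≈-refl
  units-power (suc a) = begin
    units a q * 1ℤ                      ≡⟨ trans (*-identityʳ _) (units-+ a q) ⟩
    units a 0 * rise (+ (a ℕ.* p)) q    ≈⟨ *-≈ (units-power a) (rise-multiple a) ⟩
    w ^ a * w                           ≡⟨ *-comm (w ^ a) w ⟩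
    w ^ suc a                           ∎
    where open ≈-Reasoning P³

  F-diag-≈ : ∀ j l → F (j ℕ.* p) (l ℕ.* p) ≈ F j l [ P³ ]
  F-diag-≈ j l = unit-cancelʳ (unit-lift (unit-units-cube p-prime j l {0} {0} ℕ.z≤n ℕ.z≤n)) (begin
    F (j ℕ.* p) (l ℕ.* p) * cube (units j 0 * units l 0)
      ≡⟨ F-diag j l ⟩
    F j l * (units (j ℕ.+ l) 0 * units (j ℕ.+ j) 0 * units (l ℕ.+ l) 0)
      ≈⟨ *-≈ˡ (F j l) (*-≈ (*-≈ (units-power (j ℕ.+ l)) (units-power (j ℕ.+ j))) (units-power (l ℕ.+ l))) ⟩
    F j l * (w ^ (j ℕ.+ l) * w ^ (j ℕ.+ j) * w ^ (l ℕ.+ l))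
      ≡⟨ cong (F j l *_) (pow-diag w j l) ⟩
    F j l * cube (w ^ j * w ^ l)
      ≈⟨ *-≈ˡ (F j l) (cube-≈ (*-≈ (units-power j) (units-power l))) ⟨
    F j l * cube (units j 0 * units l 0) ∎)
    where open ≈-Reasoning P³

  module _ {E : ℕ → ℤ} (isE : IsEuler E) where
    open Euler isE

    -- Inserting 2² 2^m, congruent to 1, moves the summands to the even points 2r, where
    -- `alternating-sum` applies. At the lower end `eulerPoly m 1ℤ` is 0 because `m` is even and
    -- positive; at the upper end the argument is p, congruent to 0.
    V-euler : V ≈ + 2 * (-1ℤ ^ h * E m) [ P ]
    V-euler = begin
      V
        ≡⟨ *-identityˡ V ⟨
      1ℤ * V
        ≈⟨ *-≈ʳ V (inverse-square 2<p) ⟨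
      + 2 * + 2 * (+ 2) ^ m * V
        ≡⟨ e₁ ((+ 2) ^ m) V ⟩
      + 2 * (+ 2 * (+ 2) ^ m * V)
        ≡⟨ cong (+ 2 *_) (conv-* (+ 2 * (+ 2) ^ m) (λ k _ → -1ℤ ^ suc k * invSquare k) h′) ⟨
      + 2 * conv (λ k _ → + 2 * (+ 2) ^ m * (-1ℤ ^ suc k * invSquare k)) h′
        ≡⟨ cong (+ 2 *_) (conv-cong h′ λ k _ _ → trans (e₂ ((+ 2) ^ m) (-1ℤ ^ suc k) (invSquare k))
             (cong (λ x → -1ℤ ^ suc k * (+ 2 * x)) (trans (sym (^-distribʳ-* (+ 2) (+ suc k) m)) (cong (_^ m) (e₃ (+ suc k)))))) ⟩
      + 2 * conv (λ k _ → -1ℤ ^ suc k * (+ 2 * (+ suc k + + suc k) ^ m)) h′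
        ≡⟨ cong (+ 2 *_) (alternating-sum m h′) ⟩
      + 2 * (- eulerPoly m 1ℤ + -1ℤ ^ h * eulerPoly m P)
        ≡⟨ cong (λ x → + 2 * (- x + -1ℤ ^ h * eulerPoly m P)) (shift+1-even h″) ⟩
      + 2 * (0ℤ + -1ℤ ^ h * eulerPoly m P)
        ≈⟨ *-≈ˡ (+ 2) (+-≈ (≈-refl {0ℤ}) (*-≈ˡ (-1ℤ ^ h) (shift+^-≈ m E 0 P≈0))) ⟩
      + 2 * (0ℤ + -1ℤ ^ h * E m)
        ≡⟨ cong (+ 2 *_) (+-identityˡ (-1ℤ ^ h * E m)) ⟩
      + 2 * (-1ℤ ^ h * E m) ∎
      where
      open ≈-Reasoning P
      e₁ : ∀ t v → + 2 * + 2 * t * v ≡ + 2 * (+ 2 * t * v)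
      e₁ = solve-∀
      e₂ : ∀ t s v → + 2 * t * (s * v) ≡ s * (+ 2 * (t * v))
      e₂ = solve-∀
      e₃ : ∀ x → + 2 * x ≡ x + x
      e₃ = solve-∀

    T-congruence : ∀ n → T (suc (suc n ℕ.* p))
      ≈ + 4 * (+ suc n * P + 1ℤ) * T (suc n)
        + + 32 * (+ suc n * + suc n) * T n * -1ℤ ^ h * (E m - 1ℤ) * (P * P) [ P³ ]
    T-congruence n = begin
      T (suc (suc n ℕ.* p))
        ≈⟨ T-multiple+1 n ⟩
      + 4 * (1ℤ + N * P) * T (suc n ℕ.* p) - R
        ≈⟨ +-≈ (*-≈ˡ (+ 4 * (1ℤ + N * P)) (≈-trans (T-multiple n)
             (+-≈ (conv-≈ (suc n) λ j l _ → F-diag-≈ j l) (≈-refl {P * P * (+ 4 * (N * N) * V) * T n})))) (≈-refl {x}) ⟩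
      + 4 * (1ℤ + N * P) * (T (suc n) + P * P * (+ 4 * (N * N) * V) * T n) - R
        ≡⟨ e₁ N P (T (suc n)) (T n) V (-1ℤ ^ h) ⟩
      + 4 * (N * P + 1ℤ) * T (suc n) - R + P * P * (+ 16 * (N * N) * T n * ((1ℤ + N * P) * V))
        -- Beside p² it suffices to know 1 + N p and `V` modulo p.
        ≈⟨ +-≈ (≈-refl {+ 4 * (N * P + 1ℤ) * T (suc n) - R})
             (≈-scale (P * P) (*-≈ˡ (+ 16 * (N * N) * T n) (*-≈ {b = 1ℤ} (quot N refl) V-euler))) ⟩
      + 4 * (N * P + 1ℤ) * T (suc n) - R + P * P * (+ 16 * (N * N) * T n * (1ℤ * (+ 2 * (-1ℤ ^ h * E m))))
        ≡⟨ e₂ N P (T (suc n)) (T n) (-1ℤ ^ h) (E m) ⟩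
      + 4 * (N * P + 1ℤ) * T (suc n) + + 32 * (N * N) * T n * -1ℤ ^ h * (E m - 1ℤ) * (P * P) ∎
      where
      open ≈-Reasoning P³
      N R x : ℤ
      N = + suc n
      R = + 32 * (N * N) * (-1ℤ ^ h * T n) * (P * P)
      x = - R
      e₁ : ∀ N P T t V ε → + 4 * (1ℤ + N * P) * (T + P * P * (+ 4 * (N * N) * V) * t) - + 32 * (N * N) * (ε * t) * (P * P)
        ≡ + 4 * (N * P + 1ℤ) * T - + 32 * (N * N) * (ε * t) * (P * P) + P * P * (+ 16 * (N * N) * t * ((1ℤ + N * P) * V))
      e₁ = solve-∀
      e₂ : ∀ N P T t ε E → + 4 * (N * P + 1ℤ) * T - + 32 * (N * N) * (ε * t) * (P * P) + P * P * (+ 16 * (N * N) * t * (1ℤ * (+ 2 * (ε * E))))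
        ≡ + 4 * (N * P + 1ℤ) * T + + 32 * (N * N) * t * ε * (E - 1ℤ) * (P * P)
      e₂ = solve-∀

-- The case p = 3

module Three (3-prime : Prime 3) where

  open Odd 0 3-prime
  open Blocks q

  -- The integer (a³ - a)/3, built from its differences so that no division occurs. It measures how
  -- far the blocks deviate from powers of 2 modulo 27.
  pronicSum : ℕ → ℤ
  pronicSum zero    = 0ℤ
  pronicSum (suc a) = pronicSum a + + a * (+ a + 1ℤ)

  pronicSum-cube : ∀ a → pronicSum a * + 3 ≡ + a * + a * + a - + a
  pronicSum-cube zero    = refl
  pronicSum-cube (suc a) = trans (e₁ (pronicSum a) (+ a))
    (trans (cong (_+ + a * (+ a + 1ℤ) * + 3) (pronicSum-cube a)) (e₂ (+ a)))
    where
    e₁ : ∀ t a → (t + a * (a + 1ℤ)) * + 3 ≡ t * + 3 + a * (a + 1ℤ) * + 3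
    e₁ = solve-∀
    e₂ : ∀ a → a * a * a - a + a * (a + 1ℤ) * + 3 ≡ (1ℤ + a) * (1ℤ + a) * (1ℤ + a) - (1ℤ + a)
    e₂ = solve-∀

  cube≈ : ∀ a → cube (+ a) ≈ + a [ + 3 ]
  cube≈ a = quot (pronicSum a) (trans (e (+ a)) (cong (λ z → + a + z) (sym (pronicSum-cube a))))
    where
    e : ∀ a → a * a * a ≡ a + (a * a * a - a)
    e = solve-∀

  -- A block is (3a + 1)(3a + 2) = 2 + 9a(a + 1), congruent to 2 (1 + 18 a(a + 1)) because 36 is 9
  -- modulo 27. In the product the corrections add up, since 27 divides 18².
  units-3 : ∀ a → units a 0 ≈ (+ 2) ^ a * (1ℤ + + 18 * pronicSum a) [ + 27 ]
  units-3 zero    = ≈-refl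
  units-3 (suc a) = begin
    units a 2 * 1ℤ
      ≡⟨ trans (*-identityʳ (units a 2)) (units-+ a 2) ⟩
    units a 0 * rise (+ (a ℕ.* 3)) 2
      ≡⟨ cong (λ x → units a 0 * rise x 2) (pos-* a 3) ⟩
    units a 0 * (1ℤ * (+ a * + 3 + 1ℤ) * (+ a * + 3 + + 2))
      ≈⟨ *-≈ʳ (1ℤ * (+ a * + 3 + 1ℤ) * (+ a * + 3 + + 2)) (units-3 a) ⟩
    (+ 2) ^ a * (1ℤ + + 18 * t) * (1ℤ * (+ a * + 3 + 1ℤ) * (+ a * + 3 + + 2))
      ≈⟨ quot ((+ 2) ^ a * (+ a * + a + + a) * (+ 6 * t - 1ℤ)) (e ((+ 2) ^ a) t (+ a)) ⟩
    + 2 * (+ 2) ^ a * (1ℤ + + 18 * (t + + a * (+ a + 1ℤ))) ∎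
    where
    open ≈-Reasoning (+ 27)
    t : ℤ
    t = pronicSum a
    e : ∀ x t a → x * (1ℤ + + 18 * t) * (1ℤ * (a * + 3 + 1ℤ) * (a * + 3 + + 2))
      ≡ + 2 * x * (1ℤ + + 18 * (t + a * (a + 1ℤ))) + x * (a * a + a) * (+ 6 * t - 1ℤ) * + 27
    e = solve-∀

  cube-1+18 : ∀ t → cube (1ℤ + + 18 * t) ≈ 1ℤ [ + 27 ]
  cube-1+18 t = quot (+ 2 * t + + 36 * (t * t) + + 216 * (t * t * t)) (e t)
    where
    e : ∀ t → (1ℤ + + 18 * t) * (1ℤ + + 18 * t) * (1ℤ + + 18 * t)
      ≡ 1ℤ + (+ 2 * t + + 36 * (t * t) + + 216 * (t * t * t)) * + 27
    e = solve-∀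

  -- The denominator needs no correction, because cubing annihilates 18 t modulo 27. The numerator
  -- retains 18 times three pronic sums, which `pronicSum-cube` turns into a polynomial in `j` and
  -- `l`.
  F-diag-3 : ∀ j l → F (j ℕ.* 3) (l ℕ.* 3)
    ≈ F j l * (1ℤ + + 9 * + (j ℕ.+ l) - + 9 * + (j ℕ.+ l) * (+ j * + l)) [ + 27 ]
  F-diag-3 j l = unit-cancelʳ (unit-lift unit-W) (begin
    F (j ℕ.* 3) (l ℕ.* 3) * W
      ≡⟨ e₀ (F (j ℕ.* 3) (l ℕ.* 3) * W) ⟩
    F (j ℕ.* 3) (l ℕ.* 3) * W * (1ℤ * 1ℤ)
      ≈⟨ *-≈ˡ (F (j ℕ.* 3) (l ℕ.* 3) * W) (*-≈ (cube-1+18 tj) (cube-1+18 tl)) ⟨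
    F (j ℕ.* 3) (l ℕ.* 3) * W * (cube (1ℤ + + 18 * tj) * cube (1ℤ + + 18 * tl))
      ≡⟨ e₁ (F (j ℕ.* 3) (l ℕ.* 3)) x y (1ℤ + + 18 * tj) (1ℤ + + 18 * tl) ⟩
    F (j ℕ.* 3) (l ℕ.* 3) * cube (x * (1ℤ + + 18 * tj) * (y * (1ℤ + + 18 * tl)))
      ≈⟨ *-≈ˡ (F (j ℕ.* 3) (l ℕ.* 3)) (cube-≈ (*-≈ (units-3 j) (units-3 l))) ⟨
    F (j ℕ.* 3) (l ℕ.* 3) * cube (units j 0 * units l 0)
      ≡⟨ F-diag j l ⟩
    F j l * (units (j ℕ.+ l) 0 * units (j ℕ.+ j) 0 * units (l ℕ.+ l) 0)
      ≈⟨ *-≈ˡ (F j l) (*-≈ (*-≈ (units-3 (j ℕ.+ l)) (units-3 (j ℕ.+ j))) (units-3 (l ℕ.+ l))) ⟩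
    F j l * (X * (1ℤ + + 18 * a) * (Y * (1ℤ + + 18 * b)) * (Z * (1ℤ + + 18 * c)))
      ≈⟨ quot (F j l * (X * Y * Z) * (+ 12 * (a * b + a * c + b * c) + + 216 * (a * b * c))) (e₂ (F j l) X Y Z a b c) ⟩
    F j l * (X * Y * Z * (1ℤ + + 6 * (a * + 3 + b * + 3 + c * + 3)))
      ≡⟨ cong₂ (λ u v → F j l * (u * (1ℤ + + 6 * v))) (pow-diag (+ 2) j l)
           (cong₂ _+_ (cong₂ _+_ (pronicSum-cube (j ℕ.+ l)) (pronicSum-cube (j ℕ.+ j))) (pronicSum-cube (l ℕ.+ l))) ⟩
    F j l * (W * (1ℤ + + 6 * (J+L * J+L * J+L - J+L + ((+ j + + j) * (+ j + + j) * (+ j + + j) - (+ j + + j))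
      + ((+ l + + l) * (+ l + + l) * (+ l + + l) - (+ l + + l)))))
      -- With s = j + l the bracket is 1 + 54 s³ - 18 s - 144 j l s; modulo 27 the coefficients
      -- become 0, 9 and -9.
      ≈⟨ quot (F j l * W * (+ 2 * (J+L * J+L * J+L) - J+L - + 5 * (+ j * + l * J+L))) (e₃ (F j l) W (+ j) (+ l)) ⟩
    F j l * (1ℤ + + 9 * J+L - + 9 * J+L * (+ j * + l)) * W ∎)
    where
    open ≈-Reasoning (+ 27)
    x y tj tl W a b c X Y Z J+L : ℤ
    x = (+ 2) ^ j
    y = (+ 2) ^ l
    tj = pronicSum j
    tl = pronicSum l
    W = cube (x * y)
    a = pronicSum (j ℕ.+ l)
    b = pronicSum (j ℕ.+ j)
    c = pronicSum (l ℕ.+ l)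
    X = (+ 2) ^ (j ℕ.+ l)
    Y = (+ 2) ^ (j ℕ.+ j)
    Z = (+ 2) ^ (l ℕ.+ l)
    J+L = + (j ℕ.+ l)
    unit-W : Unit (+ 3) W
    unit-W = unit-cube (unit-* (unit-^ j unit-2) (unit-^ l unit-2))
      where
      unit-2 : Unit (+ 3) (+ 2)
      unit-2 = unit (+ 2) (quot 1ℤ refl)
    e₀ : ∀ x → x ≡ x * (1ℤ * 1ℤ)
    e₀ = solve-∀
    e₁ : ∀ f x y a b → f * (x * y * (x * y) * (x * y)) * (a * a * a * (b * b * b))
      ≡ f * (x * a * (y * b) * (x * a * (y * b)) * (x * a * (y * b)))
    e₁ = solve-∀
    e₂ : ∀ f x y z a b c → f * (x * (1ℤ + + 18 * a) * (y * (1ℤ + + 18 * b)) * (z * (1ℤ + + 18 * c)))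
      ≡ f * (x * y * z * (1ℤ + + 6 * (a * + 3 + b * + 3 + c * + 3)))
        + f * (x * y * z) * (+ 12 * (a * b + a * c + b * c) + + 216 * (a * b * c)) * + 27
    e₂ = solve-∀
    e₃ : ∀ f w j l → f * (w * (1ℤ + + 6 * ((j + l) * (j + l) * (j + l) - (j + l) + ((j + j) * (j + j) * (j + j) - (j + j))
        + ((l + l) * (l + l) * (l + l) - (l + l)))))
      ≡ f * (1ℤ + + 9 * (j + l) - + 9 * (j + l) * (j * l)) * w
        + f * w * (+ 2 * ((j + l) * (j + l) * (j + l)) - (j + l) - + 5 * (j * l * (j + l))) * + 27
    e₃ = solve-∀

  T-diag-3 : ∀ n → conv (λ j l → F (j ℕ.* 3) (l ℕ.* 3)) n
    ≈ (1ℤ + + 9 * + n) * T n + - (+ 9 * + n) * Q n [ + 27 ]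
  T-diag-3 n = begin
    conv (λ j l → F (j ℕ.* 3) (l ℕ.* 3)) n
      ≈⟨ conv-≈ n (λ j l j+l≡n → ≈-trans (F-diag-3 j l) (≡⇒≈ (trans
           (cong (λ x → F j l * (1ℤ + + 9 * + x - + 9 * + x * (+ j * + l))) j+l≡n) (e (F j l) (+ n) (+ j) (+ l))))) ⟩
    conv (λ j l → (1ℤ + + 9 * + n) * F j l + - (+ 9 * + n) * (+ j * + l * F j l)) n
      ≡⟨ conv-+ (λ j l → (1ℤ + + 9 * + n) * F j l) (λ j l → - (+ 9 * + n) * (+ j * + l * F j l)) n ⟩
    conv (λ j l → (1ℤ + + 9 * + n) * F j l) n + conv (λ j l → - (+ 9 * + n) * (+ j * + l * F j l)) n
      ≡⟨ cong₂ _+_ (conv-* (1ℤ + + 9 * + n) F n) (conv-* (- (+ 9 * + n)) (λ j l → + j * + l * F j l) n) ⟩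
    (1ℤ + + 9 * + n) * T n + - (+ 9 * + n) * Q n ∎
    where
    open ≈-Reasoning (+ 27)
    e : ∀ f n j l → f * (1ℤ + + 9 * n - + 9 * n * (j * l)) ≡ (1ℤ + + 9 * n) * f + - (+ 9 * n) * (j * l * f)
    e = solve-∀

  T-rec-3 : ∀ n → + suc (suc n) * + suc (suc n) * T (suc (suc n)) ≈ T (suc n) + + suc n * + suc n * T n [ + 3 ]
  T-rec-3 n = ≈-trans (≡⇒≈ (T-rec n))
    (quot (+ 4 * (+ suc n * + suc n + + suc n) * T (suc n) + T (suc n) - + 11 * (+ suc n * + suc n * T n)) (e (+ suc n) (T (suc n)) (T n)))
    where
    e : ∀ n x y → + 4 * (+ 3 * (n * n) + + 3 * n + 1ℤ) * x - + 32 * (n * n) * y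
      ≡ x + n * n * y + (+ 4 * (n * n + n) * x + x - + 11 * (n * n * y)) * + 3
    e = solve-∀

  consecutive : ∀ n → + suc (suc n) * + suc n * + n ≈ 0ℤ [ + 3 ]
  consecutive n = begin
    + suc (suc n) * + suc n * + n                     ≡⟨ e (+ n) ⟩
    cube (+ n) + (+ n * + n * + 3 + + 2 * + n)        ≈⟨ +-≈ (cube≈ n) (≈-refl {+ n * + n * + 3 + + 2 * + n}) ⟩
    + n + (+ n * + n * + 3 + + 2 * + n)               ≡⟨ e′ (+ n) ⟩
    (+ n * + n + + n) * + 3                           ≈⟨ multiple≈0 (+ n * + n + + n) ⟩
    0ℤ ∎
    where
    open ≈-Reasoning (+ 3)
    e : ∀ n → (+ 2 + n) * (1ℤ + n) * n ≡ n * n * n + (n * n * + 3 + + 2 * n)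
    e = solve-∀
    e′ : ∀ n → n + (n * n * + 3 + + 2 * n) ≡ (n * n + n) * + 3
    e′ = solve-∀

  -- The weight vanishes modulo 3 unless n ≡ 1. All residues are treated together: N³ ≡ N supplies
  -- the square that `T-rec-3` needs, the recurrence is used at two consecutive indices, and the
  -- term from furthest back dies with a product of three consecutive integers. What remains is 3 N
  -- M B.
  T-step-3 : ∀ n → + suc n * + n * (T (suc n) + T n) ≈ 0ℤ [ + 3 ]
  T-step-3 zero          = ≈-refl
  -- Here 2 * 1 * (20 + 4) = 16 * 3; the general step reaches back too far for this index.
  T-step-3 (suc zero)    = quot (+ 16) refl
  T-step-3 (suc (suc n)) = begin
    N * M * (A + B)
      ≡⟨ *-distribˡ-+ (N * M) A B ⟩
    N * M * A + N * M * B
      ≈⟨ +-≈ (*-≈ʳ A (*-≈ʳ M (cube≈ (suc (suc (suc n)))))) (≈-refl {N * M * B}) ⟨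
    cube N * M * A + N * M * B
      ≡⟨ e₁ N M A B ⟩
    N * M * (N * N * A) + N * M * B
      ≈⟨ +-≈ (*-≈ˡ (N * M) (T-rec-3 (suc n))) (≈-refl {N * M * B}) ⟩
    N * M * (B + M * M * U) + N * M * B
      ≡⟨ e₂ N M L B U D ⟩
    + 2 * (N * M * B) + N * (cube M * (U + L * L * D)) + - (M * M * L * D * (N * M * L))
      ≈⟨ +-≈ (+-≈ (≈-refl {+ 2 * (N * M * B)}) (*-≈ˡ N (*-≈ (cube≈ (suc (suc n))) (≈-sym (T-rec-3 n)))))
             (≈-trans (≡⇒≈ (e₃ (M * M * L * D) (N * M * L))) (*-≈ˡ (- (M * M * L * D)) (consecutive (suc n)))) ⟩
    + 2 * (N * M * B) + N * (M * (M * M * B)) + - (M * M * L * D) * 0ℤ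
      ≡⟨ e₄ N M B (- (M * M * L * D)) ⟩
    + 2 * (N * M * B) + N * (cube M * B)
      ≈⟨ +-≈ (≈-refl {+ 2 * (N * M * B)}) (*-≈ˡ N (*-≈ʳ B (cube≈ (suc (suc n))))) ⟩
    + 2 * (N * M * B) + N * (M * B)
      ≡⟨ e₅ N M B ⟩
    N * M * B * + 3
      ≈⟨ multiple≈0 (N * M * B) ⟩
    0ℤ ∎
    where
    open ≈-Reasoning (+ 3)
    N M L A B U D : ℤ
    N = + suc (suc (suc n))
    M = + suc (suc n)
    L = + suc n
    A = T (suc (suc (suc n)))
    B = T (suc (suc n))
    U = T (suc n)
    D = T n
    e₁ : ∀ N M A B → N * N * N * M * A + N * M * B ≡ N * M * (N * N * A) + N * M * B
    e₁ = solve-∀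
    e₂ : ∀ N M L B U D → N * M * (B + M * M * U) + N * M * B
      ≡ + 2 * (N * M * B) + N * (M * M * M * (U + L * L * D)) + - (M * M * L * D * (N * M * L))
    e₂ = solve-∀
    e₃ : ∀ x y → - (x * y) ≡ - x * y
    e₃ = solve-∀
    e₄ : ∀ N M B x → + 2 * (N * M * B) + N * (M * (M * M * B)) + x * 0ℤ ≡ + 2 * (N * M * B) + N * (M * M * M * B)
    e₄ = solve-∀
    e₅ : ∀ N M B → + 2 * (N * M * B) + N * (M * B) ≡ N * M * B * + 3
    e₅ = solve-∀

  -- The left side is the coefficient of 9 by which `T-congruence-3` would fail. Modulo 3, `T-suc`
  -- exchanges `Q` for values of `T`, and `cube≈` lowers the degree until `T-step-3` applies.
  T-Q-3 : ∀ n → let N = + suc n in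
    N * T (suc n) - N * Q (suc n) + N * N * T n + N * N * T (suc n) ≈ 0ℤ [ + 3 ]
  T-Q-3 n = begin
    N * A - N * Z + N * N * B + N * N * A
      ≈⟨ quot (- (N * Z)) (e₁ N A B Z) ⟩
    N * A + N * N * B + N * N * A + N * (+ 4 * (N * N) * B + + 2 * Z) - + 4 * (N * N * N) * B
      ≡⟨ cong (λ x → N * A + N * N * B + N * N * A + N * x - + 4 * (N * N * N) * B) (T-suc n) ⟨
    N * A + N * N * B + N * N * A + N * (N * N * A) - + 4 * (N * N * N) * B
      ≡⟨ e₂ N A B ⟩
    N * A + N * N * B + N * N * A + cube N * (A - + 4 * B)
      ≈⟨ +-≈ (≈-refl {N * A + N * N * B + N * N * A}) (*-≈ʳ (A - + 4 * B) (cube≈ (suc n))) ⟩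
    N * A + N * N * B + N * N * A + N * (A - + 4 * B)
      ≡⟨ e₃ (+ n) A B ⟩
    N * + n * (A + B) + N * (A - B) * + 3
      ≈⟨ +-≈ (T-step-3 n) (multiple≈0 (N * (A - B))) ⟩
    0ℤ ∎
    where
    open ≈-Reasoning (+ 3)
    N A B Z : ℤ
    N = + suc n
    A = T (suc n)
    B = T n
    Z = Q (suc n)
    e₁ : ∀ N A B Z → N * A - N * Z + N * N * B + N * N * A
      ≡ N * A + N * N * B + N * N * A + N * (+ 4 * (N * N) * B + + 2 * Z) - + 4 * (N * N * N) * B + - (N * Z) * + 3
    e₁ = solve-∀
    e₂ : ∀ N A B → N * A + N * N * B + N * N * A + N * (N * N * A) - + 4 * (N * N * N) * B
      ≡ N * A + N * N * B + N * N * A + N * N * N * (A - + 4 * B)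
    e₂ = solve-∀
    e₃ : ∀ n A B → (1ℤ + n) * A + (1ℤ + n) * (1ℤ + n) * B + (1ℤ + n) * (1ℤ + n) * A + (1ℤ + n) * (A - + 4 * B)
      ≡ (1ℤ + n) * n * (A + B) + (1ℤ + n) * (A - B) * + 3
    e₃ = solve-∀

  T-congruence-3 : ∀ n → T (suc (suc n ℕ.* 3))
    ≈ (+ 4 + + 12 * + suc n - + 9 * (+ suc n * + suc n)) * T (suc n) [ + 27 ]
  T-congruence-3 n = begin
    T (suc (suc n ℕ.* 3))
      ≈⟨ T-multiple+1 n ⟩
    + 4 * (1ℤ + N * + 3) * T (suc n ℕ.* 3) + - (+ 32 * (N * N) * (-1ℤ * B) * + 9)
      -- For p = 3 one has h = 1 and m = 0, so `V` consists of the single term -1.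
      ≈⟨ +-≈ (*-≈ˡ (+ 4 * (1ℤ + N * + 3)) (≈-trans (T-multiple n)
           (+-≈ (T-diag-3 (suc n)) (≈-refl {+ 9 * (+ 4 * (N * N) * -1ℤ) * B})))) (≈-refl {x}) ⟩
    + 4 * (1ℤ + N * + 3) * ((1ℤ + + 9 * N) * A + - (+ 9 * N) * Z + + 9 * (+ 4 * (N * N) * -1ℤ) * B) + x
      ≈⟨ quot (N * A + + 4 * (N * N) * A - N * Z - + 4 * (N * N) * Z + + 5 * (N * N) * B - + 16 * (N * N * N) * B) (e₁ N A B Z) ⟩
    (+ 4 + + 12 * N - + 9 * (N * N)) * A + + 9 * (N * A - N * Z + N * N * B + N * N * A)
      ≈⟨ +-≈ (≈-refl {(+ 4 + + 12 * N - + 9 * (N * N)) * A}) (≈-scale (+ 9) (T-Q-3 n)) ⟩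
    (+ 4 + + 12 * N - + 9 * (N * N)) * A + 0ℤ
      ≡⟨ +-identityʳ _ ⟩
    (+ 4 + + 12 * N - + 9 * (N * N)) * A ∎
    where
    open ≈-Reasoning (+ 27)
    N A B Z x : ℤ
    N = + suc n
    A = T (suc n)
    B = T n
    Z = Q (suc n)
    x = - (+ 32 * (N * N) * (-1ℤ * B) * + 9)
    e₁ : ∀ N A B Z → + 4 * (1ℤ + N * + 3) * ((1ℤ + + 9 * N) * A + - (+ 9 * N) * Z + + 9 * (+ 4 * (N * N) * -1ℤ) * B)
        + - (+ 32 * (N * N) * (-1ℤ * B) * + 9)
      ≡ (+ 4 + + 12 * N - + 9 * (N * N)) * A + + 9 * (N * A - N * Z + N * N * B + N * N * A)
        + (N * A + + 4 * (N * N) * A - N * Z - + 4 * (N * N) * Z + + 5 * (N * N) * B - + 16 * (N * N * N) * B) * + 27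
    e₁ = solve-∀

-- From congruences of the binomial sum to the two cases of the statement

≈⇒mod : ∀ {a b} m → a ≈ b [ m ] → a ≡ b [mod m ]
≈⇒mod {b = b} m (quot q refl) = Signed.∣⇒∣ᵤ (Signed.divides q (e b (q * m)))
  where
  e : ∀ b x → b + x - b ≡ x
  e = solve-∀

theorem3p4 : (S : ℕ → ℤ) → IsS S →
    (E : ℕ → ℤ) → IsEuler E →
    (p : ℕ) → Prime p → 2 ∤ p →
    (n : ℕ) → n ℕ.≥ 1 →
    (p ≡ 3 →
    S (n ℕ.* p ℕ.+ 1)
    ≡ (+ 4 + + 12 * + n - + 9 * (+ n) ^ 2) * S n
    [mod (+ p) ^ 3 ])
    ×
    (p ℕ.> 3 →
    S (n ℕ.* p ℕ.+ 1)
    ≡ + 4 * (+ n * + p + + 1) * S n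
    + + 32 * (+ n) ^ 2 * S (n ℕ.∸ 1) * -1ℤ ^ ((p ℕ.∸ 1) ℕ./ 2)
    * (E (p ℕ.∸ 3) - + 1) * (+ p) ^ 2
    [mod (+ p) ^ 3 ])
theorem3p4 S isS E isE p p-prime 2∤p (suc n) _ with parity p
... | k , inj₁ p≡2k = ⊥-elim (2∤p (divides k (trans p≡2k (e k))))
  where
  e : ∀ k → k ℕ.+ k ≡ k ℕ.* 2
  e = ℕ.solve-∀
... | zero , inj₂ refl = ⊥-elim (¬prime[1] p-prime)
... | suc zero , inj₂ refl =
    (λ _ → ≈⇒mod (+ 27) (begin
      S (suc n ℕ.* 3 ℕ.+ 1)                                              ≡⟨ trans (S≡T isS _) (cong T (ℕ.+-comm (suc n ℕ.* 3) 1)) ⟩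
      T (suc (suc n ℕ.* 3))                                              ≈⟨ T-congruence-3 n ⟩
      (+ 4 + + 12 * + suc n - + 9 * (+ suc n * + suc n)) * T (suc n)     ≡⟨ cong₂ _*_ (e (+ suc n)) (sym (S≡T isS (suc n))) ⟩
      (+ 4 + + 12 * + suc n - + 9 * (+ suc n) ^ 2) * S (suc n)           ∎))
  , (λ 3>3 → ⊥-elim (ℕ.<-irrefl refl 3>3))
  where
  open Three p-prime
  open ≈-Reasoning (+ 27)
  e : ∀ n → + 4 + + 12 * n - + 9 * (n * n) ≡ + 4 + + 12 * n - + 9 * (n * (n * 1ℤ))
  e = solve-∀
... | suc (suc h″) , inj₂ refl =
    -- Here p = 2 h″ + 5, so p - 3 is a successor.
    (λ p≡3 → ⊥-elim (ℕ.m+1+n≢0 h″ (cong (ℕ._∸ 3) p≡3)))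
  -- The modulus changes from the product `P * P * P`, the form suited to `unit-lift` and `≈-scale`,
  -- to the power in the statement.
  , (λ _ → ≈⇒mod (P ^ 3) (subst (S (suc n ℕ.* p ℕ.+ 1) ≈ rhs [_]) (e₁ P) (begin
      S (suc n ℕ.* p ℕ.+ 1)
        ≡⟨ trans (S≡T isS _) (cong T (ℕ.+-comm (suc n ℕ.* p) 1)) ⟩
      T (suc (suc n ℕ.* p))
        ≈⟨ T-congruence isE n ⟩
      + 4 * (N * P + 1ℤ) * T (suc n) + + 32 * (N * N) * T n * -1ℤ ^ h * (E m - 1ℤ) * (P * P)
        ≡⟨ cong₂ (λ x y → + 4 * (N * P + 1ℤ) * x + + 32 * (N * N) * y * -1ℤ ^ h * (E m - 1ℤ) * (P * P))
             (S≡T isS (suc n)) (S≡T isS n) ⟨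
      + 4 * (N * P + 1ℤ) * S (suc n) + + 32 * (N * N) * S n * -1ℤ ^ h * (E m - 1ℤ) * (P * P)
        ≡⟨ cong₂ (λ x y → + 4 * (N * P + 1ℤ) * S (suc n) + + 32 * (N * N) * S n * -1ℤ ^ x * (E y - 1ℤ) * (P * P))
             q/2≡h p∸3≡m ⟨
      + 4 * (N * P + 1ℤ) * S (suc n) + + 32 * (N * N) * S n * -1ℤ ^ (q ℕ./ 2) * (E (p ℕ.∸ 3) - 1ℤ) * (P * P)
        ≡⟨ e₂ N P (S (suc n)) (S n) (-1ℤ ^ (q ℕ./ 2)) (E (p ℕ.∸ 3)) ⟩
      rhs ∎)))
  where
  open Wolstenholme h″ p-prime
  open Odd h′ p-prime using (h; q; m; P³)
  open Blocks q using (P)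
  open ≈-Reasoning P³
  N rhs : ℤ
  N = + suc n
  rhs = + 4 * (N * P + + 1) * S (suc n)
    + + 32 * N ^ 2 * S n * -1ℤ ^ (q ℕ./ 2) * (E (p ℕ.∸ 3) - + 1) * P ^ 2
  q/2≡h : q ℕ./ 2 ≡ h
  q/2≡h = trans (cong (ℕ._/ 2) (e h)) (ℕ.m*n/n≡m h 2)
    where
    e : ∀ h → h ℕ.+ h ≡ h ℕ.* 2
    e = ℕ.solve-∀
  p∸3≡m : p ℕ.∸ 3 ≡ m
  p∸3≡m = cong (ℕ._∸ 1) (ℕ.+-suc h′ h′)
  e₁ : ∀ P → P * P * P ≡ P * (P * (P * 1ℤ))
  e₁ = solve-∀
  e₂ : ∀ N P x y ε E → + 4 * (N * P + 1ℤ) * x + + 32 * (N * N) * y * ε * (E - 1ℤ) * (P * P)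
    ≡ + 4 * (N * P + 1ℤ) * x + + 32 * (N * (N * 1ℤ)) * y * ε * (E - 1ℤ) * (P * (P * 1ℤ))
  e₂ = solve-∀
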